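{- Let $b\in\mathbb{Z}$ with $b\equiv 1\pmod{32}$. Then for every integer $r\ge 3$ such that $x^{2^r}-b$ is irreducible over $\mathbb{Q}$, the pure number field $\mathbb{Q}(\sqrt[2^r]{b})$ is not monogenic.
   Context: $\sqrt[2^r]{b}$ denotes a root of $x^{2^r}-b$. For a number field $K$ with ring of integers $\mathbb{Z}_K$, $K$ is called monogenic if there exists $\eta\in\mathbb{Z}_K$ with $\mathbb{Z}_K=\mathbb{Z}[\eta]$. -}

module Defs where

open import Level using (0ℓ; suc; _⊔_)
open import Algebra.Apartness.Bundles using (HeytingField; HeytingCommutativeRing)
open import Algebra.Bundles using (CommutativeRing; RawSemiring)
open import Algebra.Definitions.RawSemiring using (Irreducible)
open import Algebra.Morphism.Structures using (IsRingHomomorphism)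
open import Data.Integer.Base as ℤ using (ℤ; 1ℤ)
open import Data.List.Base using (List; []; _∷_; _∷ʳ_; foldr; map; replicate)
open import Data.Nat.Base as ℕ using (ℕ)
open import Data.Product.Base using (_×_; ∃-syntax)
open import Data.Rational.Base as ℚ using (ℚ; 0ℚ; 1ℚ)
open import Function.Bundles using (_⇔_)
open import Relation.Binary.PropositionalEquality using (_≡_)
open import Relation.Unary using (Pred)

infixl 6 _+ₚ_
infixl 7 _*ₚ_
infix  4 _≈ₚ_

-- Coefficients are listed from the constant term upwards; trailing zeros are
-- allowed, so polynomials are compared with _≈ₚ_ rather than _≡_.
ℚ[x] : Set
ℚ[x] = List ℚ

ℤ[x] : Set
ℤ[x] = List ℤ

coeff : ℚ[x] → ℕ → ℚ
coeff []      _         = 0ℚ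
coeff (a ∷ _) ℕ.zero    = a
coeff (_ ∷ p) (ℕ.suc k) = coeff p k

_≈ₚ_ : ℚ[x] → ℚ[x] → Set
p ≈ₚ q = ∀ k → coeff p k ≡ coeff q k

_+ₚ_ : ℚ[x] → ℚ[x] → ℚ[x]
[]      +ₚ q       = q
(a ∷ p) +ₚ []      = a ∷ p
(a ∷ p) +ₚ (c ∷ q) = (a ℚ.+ c) ∷ (p +ₚ q)

_*ₚ_ : ℚ[x] → ℚ[x] → ℚ[x]
[]      *ₚ q = []
(a ∷ p) *ₚ q = map (a ℚ.*_) q +ₚ (0ℚ ∷ (p *ₚ q))

ℚ[x]-rawSemiring : RawSemiring 0ℓ 0ℓ
ℚ[x]-rawSemiring = record
  { Carrier = ℚ[x]
  ; _≈_     = _≈ₚ_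
  ; _+_     = _+ₚ_
  ; _*_     = _*ₚ_
  ; 0#      = []
  ; 1#      = 1ℚ ∷ []
  }

Irreducibleℚ : ℚ[x] → Set
Irreducibleℚ = Irreducible ℚ[x]-rawSemiring

fromℤ : ℤ → ℚ
fromℤ m = m ℚ./ 1

x^_ : ℕ → ℚ[x]
x^ n = replicate n 0ℚ ∷ʳ 1ℚ

x^_-const_ : ℕ → ℤ → ℚ[x]
x^ n -const b = (x^ n) +ₚ (ℚ.- fromℤ b ∷ [])

-- A field containing ℚ.  A ring homomorphism out of ℚ into a field is
-- automatically injective, since 0# ≉ 1# holds in every Heyting field.
record FieldOverℚ c ℓ₁ ℓ₂ : Set (suc (c ⊔ ℓ₁ ⊔ ℓ₂)) where
  field
    heytingField : HeytingField c ℓ₁ ℓ₂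

  open HeytingField heytingField public

  commutativeRing : CommutativeRing c ℓ₁
  commutativeRing = HeytingCommutativeRing.commutativeRing heytingCommutativeRing

  open CommutativeRing commutativeRing public using (rawRing)

  field
    ι                    : ℚ → Carrier
    ι-isRingHomomorphism : IsRingHomomorphism ℚ.+-*-rawRing rawRing ι

module _ {c ℓ₁ ℓ₂} (L : FieldOverℚ c ℓ₁ ℓ₂) where
  open FieldOverℚ L

  eval : ℚ[x] → Carrier → Carrier
  eval p x = foldr (λ a acc → ι a + x * acc) 0# p

  evalℤ : ℤ[x] → Carrier → Carrier
  evalℤ p = eval (map fromℤ p)

  IsRoot : ℚ[x] → Carrier → Set ℓ₁
  IsRoot p x = eval p x ≈ 0#

  -- ℚ⟨ α ⟩ is the field ℚ(α): the least subfield of L containing ℚ and α.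
  data ℚ⟨_⟩ (α : Carrier) : Pred Carrier (c ⊔ ℓ₁) where
    scalar : ∀ q → ℚ⟨ α ⟩ (ι q)
    gen    : ℚ⟨ α ⟩ α
    add    : ∀ {x y} → ℚ⟨ α ⟩ x → ℚ⟨ α ⟩ y → ℚ⟨ α ⟩ (x + y)
    neg    : ∀ {x} → ℚ⟨ α ⟩ x → ℚ⟨ α ⟩ (- x)
    mul    : ∀ {x y} → ℚ⟨ α ⟩ x → ℚ⟨ α ⟩ y → ℚ⟨ α ⟩ (x * y)
    inv    : ∀ {x y} → ℚ⟨ α ⟩ x → x * y ≈ 1# → ℚ⟨ α ⟩ y
    resp   : ∀ {x y} → x ≈ y → ℚ⟨ α ⟩ x → ℚ⟨ α ⟩ y

  -- The polynomial p ∷ʳ 1ℤ ranges over the monic integer polynomials.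
  IsIntegral : Pred Carrier ℓ₁
  IsIntegral x = ∃[ p ] evalℤ (p ∷ʳ 1ℤ) x ≈ 0#

  𝓞 : ∀ {k} → Pred Carrier k → Pred Carrier (k ⊔ ℓ₁)
  𝓞 K x = K x × IsIntegral x

  ℤ[_] : Carrier → Pred Carrier ℓ₁
  ℤ[ η ] x = ∃[ p ] x ≈ evalℤ p η

  Monogenic : ∀ {k} → Pred Carrier k → Set (c ⊔ k ⊔ ℓ₁)
  Monogenic K = ∃[ η ] 𝓞 K η × (∀ x → 𝓞 K x ⇔ ℤ[ η ] x)

{-# OPTIONS --safe #-}

-- Suppose ℤ_K = ℤ[η] and let u(η) be an element of ℤ_K.  A ring homomorphism ℤ_K → 𝔽₂ sends η to
-- some t ∈ 𝔽₂ and u(η) to u(t), so there are at most two such homomorphisms.  But there are three: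
-- write b = c⁸ in ℤ₂ with c ≡ 1 (mod 4).  Over ℤ₂ the polynomial xⁿ - b, n = 2ʳ, has the factors
-- x^(n/2) + c⁴, x^(n/4) + c² and x^(n/8) + c, each of which is Eisenstein at 2 after x ↦ x + 1 and
-- hence gives a prime with residue field 𝔽₂.  With y = α^(n/4), the integral element
-- e = (y² + 1)/2 has residues 0, 1, 1 at them, and v = (y + 1) e/2 has residues 0, 1 at the last two.
--
-- To stay within ℤ, c is only taken modulo a high power 2ᴺ, and instead of completing K we transfer
-- polynomial relations in α to congruences modulo 2ᴺ in ℤ[ρ], where ρ is a root of the factor.

module Submission where

-- No homomorphism on ℤ_K is constructed; only the residue `t` of `η` is. Write `d η = q(α)` with
-- `d = 2ᵏ σ` and σ odd. Integrality bounds the denominators of all powers of `η`, and ℤ[ρ] is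
-- integrally closed at 2 because a power of `π = ρ - 1` is 2 times an element of residue 1. Hence
-- `2ᵏ` divides `q(ρ)`, and the residue of the quotient serves as `t`, since σ has residue 1. The
-- obstacle is that relations in α reach ρ only modulo `2ᴺ`, and each division by a power of 2 costs
-- precision. The loss depends on `η`, on its integral equation and on the polynomials expressing
-- `e` and `v`, so `N`, and with it `c`, is fixed only after all of these are given. The modulus 32
-- is the precision at which the lifting of an eighth root can start from `c = 1`. The roots of the
-- three factors have powers `γ = -c⁴, -c², -c`, all congruent to 3 modulo 4, so that `1 - γ` is
-- twice an odd number: this is the Eisenstein condition after the shift.

open import Defs
import Algebra.Apartness.Properties.HeytingCommutativeRing as HeytingProperties
open import Algebra.Apartness.Bundles using (HeytingField)
open import Algebra.Bundles using (AbelianGroup; CommutativeRing)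
import Algebra.Construct.DirectProduct as DirectProduct
import Algebra.Definitions.RawMagma as RawMagma
open import Algebra.Definitions.RawSemiring using (Irreducible)
import Algebra.Morphism.Construct.Composition as Composition
import Algebra.Morphism.Construct.Identity as Identity
open import Algebra.Morphism.Structures using (IsRingHomomorphism)
import Algebra.Solver.Ring as RingSolver
open import Algebra.Solver.Ring.AlmostCommutativeRing using (fromCommutativeRing; _-Raw-AlmostCommutative⟶_)
open import Data.Empty using (⊥; ⊥-elim)
open import Data.Integer.Base as ℤ using (ℤ; +_; 0ℤ; 1ℤ)
open import Data.Integer.Divisibility using (_∣_)
import Data.Integer.Divisibility.Signed as Signed
import Data.Integer.Properties as ℤₚ
open import Data.Integer.Solver using () renaming (module +-*-Solver to ℤSolver)
open import Data.List.Base as List using (List; []; _∷_; _∷ʳ_; foldr; map)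
import Data.List.Properties as Listₚ
open import Data.Maybe.Base as Maybe using (Maybe)
open import Data.Nat.Base as ℕ using (ℕ; zero; suc; z≤n; s≤s; _<_; _≤_)
open import Data.Nat.Induction using (<-rec)
import Data.Nat.Properties as ℕₚ
open import Data.Nat.Solver using () renaming (module +-*-Solver to ℕSolver)
open import Data.Parity.Base as ℙ using (Parity; 0ℙ; 1ℙ)
import Data.Parity.Properties as ℙₚ
open import Data.Product.Base using (_×_; _,_; ∃-syntax; proj₁; proj₂)
open import Data.Rational.Base as ℚ using (ℚ; 0ℚ; 1ℚ)
import Data.Rational.Properties as ℚₚ
open import Data.Rational.Solver using (module +-*-Solver)
open import Data.Rational.Unnormalised.Base as ℚᵘ using (mkℚᵘ; *≡*)
import Data.Rational.Unnormalised.Properties as ℚᵘₚ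
open import Data.Sum.Base using (_⊎_; inj₁; inj₂)
open import Data.Vec.Base as Vec using (Vec; []; _∷_; toList)
import Data.Vec.Properties as Vecₚ
open import Function.Bundles using (Equivalence)
open import Level using (0ℓ; _⊔_) renaming (suc to ℓsuc)
open import Relation.Binary.PropositionalEquality as ≡ using (_≡_; _≢_; cong; cong₂; module ≡-Reasoning)
import Relation.Binary.Reasoning.Setoid as ≈-Reasoning
open import Relation.Nullary.Decidable using (yes; no; dec⇒maybe)
open import Relation.Nullary.Negation.Core using (¬_)

-- Commutative rings over ℤ and reduction of polynomials modulo a monic one

-- One interface for every ring in which integer polynomials are evaluated: `L`, ℤ, the rings ℤ[ρ],
-- their quotients and 𝔽₂.
record ℤAlgebra c ℓ : Set (ℓsuc (c ⊔ ℓ)) where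
  field
    commutativeRing      : CommutativeRing c ℓ
  open CommutativeRing commutativeRing public
  field
    κ                    : ℤ → Carrier
    κ-isRingHomomorphism : IsRingHomomorphism ℤ.+-*-rawRing rawRing κ

  open IsRingHomomorphism κ-isRingHomomorphism public
    using () renaming (+-homo to κ-+; *-homo to κ-*; -‿homo to κ-neg; 0#-homo to κ-0; 1#-homo to κ-1)
  open import Algebra.Properties.Semiring.Exp semiring public
  open import Algebra.Properties.CommutativeSemiring.Exp commutativeSemiring public using (^-distrib-*)
  open import Algebra.Properties.Ring ring public using (x≈y⇒x∙y⁻¹≈ε; x∙y⁻¹≈ε⇒x≈y)

  -- κ, except that the solver constants 0ℤ and 1ℤ denote 0# and 1# on the nose.
  private
    κ′ : ℤ → Carrier
    κ′ (+ 0) = 0#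
    κ′ (+ 1) = 1#
    κ′ a     = κ a

    κ′≈κ : ∀ a → κ′ a ≈ κ a
    κ′≈κ (+ 0)           = sym κ-0
    κ′≈κ (+ 1)           = sym κ-1
    κ′≈κ (+ suc (suc _)) = refl
    κ′≈κ (ℤ.-[1+ _ ])    = refl

    κ′-morphism : ℤ.+-*-rawRing -Raw-AlmostCommutative⟶ fromCommutativeRing commutativeRing
    κ′-morphism = record
      { ⟦_⟧    = κ′
      ; +-homo = λ a b → trans (κ′≈κ (a ℤ.+ b)) (trans (κ-+ a b) (sym (+-cong (κ′≈κ a) (κ′≈κ b))))
      ; *-homo = λ a b → trans (κ′≈κ (a ℤ.* b)) (trans (κ-* a b) (sym (*-cong (κ′≈κ a) (κ′≈κ b))))
      ; -‿homo = λ a → trans (κ′≈κ (ℤ.- a)) (trans (κ-neg a) (sym (-‿cong (κ′≈κ a))))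
      ; 0-homo = refl
      ; 1-homo = refl
      }

    κ′-≟ : ∀ a b → Maybe (κ′ a ≈ κ′ b)
    κ′-≟ a b = Maybe.map (λ a≡b → reflexive (≡.cong κ′ a≡b)) (dec⇒maybe (a ℤₚ.≟ b))

  module Solver = RingSolver ℤ.+-*-rawRing (fromCommutativeRing commutativeRing) κ′-morphism κ′-≟

  value : List ℤ → Carrier → Carrier
  value p x = foldr (λ a acc → κ a + x * acc) 0# p

  2# : Carrier
  2# = κ (+ 2)

  κ-^ : ∀ a n → κ (a ℤ.^ n) ≈ κ a ^ n
  κ-^ a zero    = κ-1
  κ-^ a (suc n) = trans (κ-* a (a ℤ.^ n)) (*-congˡ (κ-^ a n))

-- The top coefficient overflows when a new constant term is pushed in.
push : ∀ {n} → ℤ → Vec ℤ n → Vec ℤ n × ℤ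
push a []      = [] , a
push a (b ∷ v) = a ∷ proj₁ (push b v) , proj₂ (push b v)

-- Coefficient vectors of length n stand for polynomials modulo xⁿ - g(x).
module Reduction {n} (g : Vec ℤ n) where

  addᵥ : ∀ {m} → Vec ℤ m → Vec ℤ m → Vec ℤ m
  addᵥ = Vec.zipWith ℤ._+_

  scaleᵥ : ∀ {m} → ℤ → Vec ℤ m → Vec ℤ m
  scaleᵥ a = Vec.map (a ℤ.*_)

  shiftᵥ : Vec ℤ n → Vec ℤ n
  shiftᵥ v = addᵥ (proj₁ (push 0ℤ v)) (scaleᵥ (proj₂ (push 0ℤ v)) g)

  mulᵥ : ∀ {m} → Vec ℤ m → Vec ℤ n → Vec ℤ n
  mulᵥ []      w = Vec.replicate n 0ℤ
  mulᵥ (a ∷ v) w = addᵥ (scaleᵥ a w) (shiftᵥ (mulᵥ v w))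

  oneᵥ : ∀ {m} → Vec ℤ m
  oneᵥ {zero}  = []
  oneᵥ {suc m} = 1ℤ ∷ Vec.replicate m 0ℤ

  powᵥ : ℕ → Vec ℤ n
  powᵥ zero    = oneᵥ
  powᵥ (suc i) = shiftᵥ (powᵥ i)

  module _ {c ℓ} (A : ℤAlgebra c ℓ) where
    open ℤAlgebra A

    ev : ∀ {m} → Vec ℤ m → Carrier → Carrier
    ev v = value (toList v)

    ev-add : ∀ {m} (v w : Vec ℤ m) x → ev (addᵥ v w) x ≈ ev v x + ev w x
    ev-add []      []      x = sym (+-identityˡ 0#)
    ev-add (a ∷ v) (b ∷ w) x = trans (+-cong (κ-+ a b) (*-congˡ (ev-add v w x)))
      (solve 5 (λ a b x v w → (a :+ b) :+ x :* (v :+ w) := (a :+ x :* v) :+ (b :+ x :* w)) refl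
        (κ a) (κ b) x (ev v x) (ev w x))
      where open Solver

    ev-scale : ∀ {m} a (v : Vec ℤ m) x → ev (scaleᵥ a v) x ≈ κ a * ev v x
    ev-scale a []      x = sym (zeroʳ (κ a))
    ev-scale a (b ∷ v) x = trans (+-cong (κ-* a b) (*-congˡ (ev-scale a v x)))
      (solve 4 (λ a b x v → a :* b :+ x :* (a :* v) := a :* (b :+ x :* v)) refl (κ a) (κ b) x (ev v x))
      where open Solver

    ev-push : ∀ {m} a (v : Vec ℤ m) x →
              ev (proj₁ (push a v)) x + κ (proj₂ (push a v)) * x ^ m ≈ κ a + x * ev v x
    ev-push {zero} a [] x = solve 2 (λ a x → con 0ℤ :+ a :* con 1ℤ := a :+ x :* con 0ℤ) refl (κ a) x
      where open Solver
    ev-push {suc m} a (b ∷ v) x = trans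
      (solve 5 (λ a x e t p → (a :+ x :* e) :+ t :* (x :* p) := a :+ x :* (e :+ t :* p)) refl
        (κ a) x (ev (proj₁ (push b v)) x) (κ (proj₂ (push b v))) (x ^ m))
      (+-congˡ (*-congˡ (ev-push b v x)))
      where open Solver

    ev-zero : ∀ m x → ev (Vec.replicate m 0ℤ) x ≈ 0#
    ev-zero zero    x = refl
    ev-zero (suc m) x = trans (+-cong κ-0 (*-congˡ (ev-zero m x)))
      (solve 1 (λ x → con 0ℤ :+ x :* con 0ℤ := con 0ℤ) refl x)
      where open Solver

    ev-one : ∀ {m} x → 0 ℕ.< m → ev (oneᵥ {m}) x ≈ 1#
    ev-one {suc m} x _ = trans (+-cong κ-1 (*-congˡ (ev-zero m x)))
      (solve 1 (λ x → con 1ℤ :+ x :* con 0ℤ := con 1ℤ) refl x)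
      where open Solver

    ev-constant : ∀ {m} a x → 0 ℕ.< m → ev (scaleᵥ {m} a oneᵥ) x ≈ κ a
    ev-constant {m} a x 0<m = trans (ev-scale a (oneᵥ {m}) x) (trans (*-congˡ (ev-one x 0<m)) (*-identityʳ (κ a)))

  module Evaluation {c ℓ} (A : ℤAlgebra c ℓ) (x : ℤAlgebra.Carrier A)
                    (0<n : 0 ℕ.< n)
                    (xⁿ≈g : ℤAlgebra._≈_ A (ℤAlgebra._^_ A x n) (ℤAlgebra.value A (toList g) x)) where
    open ℤAlgebra A
    open Solver

    ev-shift : ∀ v → ev A (shiftᵥ v) x ≈ x * ev A v x
    ev-shift v = trans (ev-add A (proj₁ (push 0ℤ v)) _ x)
      (trans (+-congˡ (trans (ev-scale A (proj₂ (push 0ℤ v)) g x) (*-congˡ (sym xⁿ≈g))))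
      (trans (ev-push A 0ℤ v x) (trans (+-congʳ κ-0) (+-identityˡ _))))

    ev-mul : ∀ {m} (v : Vec ℤ m) w → ev A (mulᵥ v w) x ≈ ev A v x * ev A w x
    ev-mul []      w = trans (ev-zero A n x) (sym (zeroˡ _))
    ev-mul (a ∷ v) w = trans (ev-add A (scaleᵥ a w) _ x)
      (trans (+-cong (ev-scale A a w x) (trans (ev-shift (mulᵥ v w)) (*-congˡ (ev-mul v w))))
      (solve 4 (λ a w x v → a :* w :+ x :* (v :* w) := (a :+ x :* v) :* w) refl (κ a) (ev A w x) x (ev A v x)))

    -- For an integral element this writes every power as the value of a polynomial whose length
    -- does not depend on the exponent.
    ev-pow : ∀ i → ev A (powᵥ i) x ≈ x ^ i
    ev-pow zero    = ev-one A x 0<n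
    ev-pow (suc i) = trans (ev-shift (powᵥ i)) (*-congˡ (ev-pow i))

-- Polynomials over ℚ

fromℚᵘ-homo-+ : ∀ p q → ℚ.fromℚᵘ (p ℚᵘ.+ q) ≡ ℚ.fromℚᵘ p ℚ.+ ℚ.fromℚᵘ q
fromℚᵘ-homo-+ p q = ℚₚ.toℚᵘ-injective (ℚᵘₚ.≃-trans (ℚₚ.toℚᵘ-fromℚᵘ (p ℚᵘ.+ q))
  (ℚᵘₚ.≃-sym (ℚᵘₚ.≃-trans (ℚₚ.toℚᵘ-homo-+ (ℚ.fromℚᵘ p) (ℚ.fromℚᵘ q))
    (ℚᵘₚ.+-cong (ℚₚ.toℚᵘ-fromℚᵘ p) (ℚₚ.toℚᵘ-fromℚᵘ q)))))

fromℚᵘ-homo-* : ∀ p q → ℚ.fromℚᵘ (p ℚᵘ.* q) ≡ ℚ.fromℚᵘ p ℚ.* ℚ.fromℚᵘ q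
fromℚᵘ-homo-* p q = ℚₚ.toℚᵘ-injective (ℚᵘₚ.≃-trans (ℚₚ.toℚᵘ-fromℚᵘ (p ℚᵘ.* q))
  (ℚᵘₚ.≃-sym (ℚᵘₚ.≃-trans (ℚₚ.toℚᵘ-homo-* (ℚ.fromℚᵘ p) (ℚ.fromℚᵘ q))
    (ℚᵘₚ.*-cong (ℚₚ.toℚᵘ-fromℚᵘ p) (ℚₚ.toℚᵘ-fromℚᵘ q)))))

fromℤ-homo-+ : ∀ a b → fromℤ (a ℤ.+ b) ≡ fromℤ a ℚ.+ fromℤ b
fromℤ-homo-+ a b = ≡.trans
  (ℚₚ.fromℚᵘ-cong {mkℚᵘ (a ℤ.+ b) 0} {mkℚᵘ a 0 ℚᵘ.+ mkℚᵘ b 0}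
    (*≡* (cong (ℤ._* 1ℤ) (≡.sym (cong₂ ℤ._+_ (ℤₚ.*-identityʳ a) (ℤₚ.*-identityʳ b))))))
  (fromℚᵘ-homo-+ (mkℚᵘ a 0) (mkℚᵘ b 0))

fromℤ-homo-* : ∀ a b → fromℤ (a ℤ.* b) ≡ fromℤ a ℚ.* fromℤ b
fromℤ-homo-* a b = fromℚᵘ-homo-* (mkℚᵘ a 0) (mkℚᵘ b 0)

fromℤ-injective : ∀ {a b} → fromℤ a ≡ fromℤ b → a ≡ b
fromℤ-injective {a} {b} eq with ℚₚ.fromℚᵘ-injective {mkℚᵘ a 0} {mkℚᵘ b 0} eq
... | *≡* a*1≡b*1 = ℤₚ.*-cancelʳ-≡ a b 1ℤ a*1≡b*1

fromℤ-homo-neg : ∀ a → fromℤ (ℤ.- a) ≡ ℚ.- fromℤ a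
fromℤ-homo-neg a = ℚₚ.toℚᵘ-injective (ℚᵘₚ.≃-trans (ℚₚ.toℚᵘ-fromℚᵘ (mkℚᵘ (ℤ.- a) 0))
  (ℚᵘₚ.≃-sym (ℚᵘₚ.≃-trans (ℚₚ.toℚᵘ-homo‿- (fromℤ a)) (ℚᵘₚ.-‿cong (ℚₚ.toℚᵘ-fromℚᵘ (mkℚᵘ a 0))))))

fromℤ-isRingHomomorphism : IsRingHomomorphism ℤ.+-*-rawRing ℚ.+-*-rawRing fromℤ
fromℤ-isRingHomomorphism = record
  { isSemiringHomomorphism = record
    { isNearSemiringHomomorphism = record
      { +-isMonoidHomomorphism = record
        { isMagmaHomomorphism = record
          { isRelHomomorphism = record { cong = cong fromℤ }
          ; homo = fromℤ-homo-+
          }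
        ; ε-homo = ≡.refl
        }
      ; *-homo = fromℤ-homo-*
      }
    ; 1#-homo = ≡.refl
    }
  ; -‿homo = fromℤ-homo-neg
  }

coeff-+ : ∀ p q k → coeff (p +ₚ q) k ≡ coeff p k ℚ.+ coeff q k
coeff-+ []      q       k       = ≡.sym (ℚₚ.+-identityˡ (coeff q k))
coeff-+ (a ∷ p) []      k       = ≡.sym (ℚₚ.+-identityʳ (coeff (a ∷ p) k))
coeff-+ (a ∷ p) (c ∷ q) zero    = ≡.refl
coeff-+ (a ∷ p) (c ∷ q) (suc k) = coeff-+ p q k

coeff-scale : ∀ a p k → coeff (map (a ℚ.*_) p) k ≡ a ℚ.* coeff p k
coeff-scale a []      k       = ≡.sym (ℚₚ.*-zeroʳ a)
coeff-scale a (c ∷ p) zero    = ≡.refl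
coeff-scale a (c ∷ p) (suc k) = coeff-scale a p k

coeff-∷* : ∀ a p q k → coeff ((a ∷ p) *ₚ q) k ≡ a ℚ.* coeff q k ℚ.+ coeff (0ℚ ∷ (p *ₚ q)) k
coeff-∷* a p q k = ≡.trans (coeff-+ (map (a ℚ.*_) q) _ k) (cong (ℚ._+ _) (coeff-scale a q k))

IsZero : ℚ[x] → Set
IsZero p = ∀ k → coeff p k ≡ 0ℚ

IsTop : ℚ[x] → ℕ → Set
IsTop p l = coeff p l ≢ 0ℚ × (∀ k → l < k → coeff p k ≡ 0ℚ)

zero⊎top : ∀ p → IsZero p ⊎ ∃[ l ] IsTop p l
zero⊎top [] = inj₁ λ _ → ≡.refl
zero⊎top (a ∷ p) with zero⊎top p
... | inj₂ (l , c≢0 , above) = inj₂ (suc l , c≢0 , λ { (suc k) (s≤s l<k) → above k l<k })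
... | inj₁ p≈0 with a ℚₚ.≟ 0ℚ
...   | yes a≡0 = inj₁ λ { zero → a≡0 ; (suc k) → p≈0 k }
...   | no  a≢0 = inj₂ (0 , a≢0 , λ { (suc k) _ → p≈0 k })

zero-* : ∀ p q → IsZero p → IsZero (p *ₚ q)
zero-* []      q p≈0 k = ≡.refl
zero-* (a ∷ p) q p≈0 k = begin
  coeff ((a ∷ p) *ₚ q) k                         ≡⟨ coeff-∷* a p q k ⟩
  a ℚ.* coeff q k ℚ.+ coeff (0ℚ ∷ (p *ₚ q)) k    ≡⟨ cong₂ ℚ._+_ (cong (ℚ._* coeff q k) (p≈0 0)) (tail k) ⟩
  0ℚ ℚ.* coeff q k ℚ.+ 0ℚ                        ≡⟨ ≡.trans (ℚₚ.+-identityʳ _) (ℚₚ.*-zeroˡ (coeff q k)) ⟩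
  0ℚ                                             ∎
  where
  open ≡-Reasoning
  tail : IsZero (0ℚ ∷ (p *ₚ q))
  tail zero    = ≡.refl
  tail (suc k) = zero-* p q (λ j → p≈0 (suc j)) k

constant-* : ∀ p q → (∀ k → 0 < k → coeff p k ≡ 0ℚ) → ∀ k → coeff (p *ₚ q) k ≡ coeff p 0 ℚ.* coeff q k
constant-* []      q p≈c k = ≡.sym (ℚₚ.*-zeroˡ (coeff q k))
constant-* (a ∷ p) q p≈c k = ≡.trans (coeff-∷* a p q k)
  (≡.trans (cong (a ℚ.* coeff q k ℚ.+_) (tail k)) (ℚₚ.+-identityʳ _))
  where
  tail : IsZero (0ℚ ∷ (p *ₚ q))
  tail zero    = ≡.refl
  tail (suc k) = zero-* p q (λ j → p≈c (suc j) (s≤s z≤n)) k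

*-inverseʳ-cancel : ∀ a c .{{_ : ℚ.NonZero c}} → a ℚ.* (ℚ.1/ c) ℚ.* c ≡ a
*-inverseʳ-cancel a c = begin
  a ℚ.* (ℚ.1/ c) ℚ.* c     ≡⟨ ℚₚ.*-assoc a (ℚ.1/ c) c ⟩
  a ℚ.* (ℚ.1/ c ℚ.* c)     ≡⟨ cong (a ℚ.*_) (ℚₚ.*-inverseˡ c) ⟩
  a ℚ.* 1ℚ                 ≡⟨ ℚₚ.*-identityʳ a ⟩
  a                        ∎
  where open ≡-Reasoning

nonzero-cancel : ∀ {a c} → c ≢ 0ℚ → a ℚ.* c ≡ 0ℚ → a ≡ 0ℚ
nonzero-cancel {a} {c} c≢0 ac≡0 = begin
  a                        ≡⟨ *-inverseʳ-cancel a c ⟨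
  a ℚ.* (ℚ.1/ c) ℚ.* c     ≡⟨ solve 3 (λ a c c⁻¹ → a :* c⁻¹ :* c := a :* c :* c⁻¹) ≡.refl a c (ℚ.1/ c) ⟩
  a ℚ.* c ℚ.* (ℚ.1/ c)     ≡⟨ cong (ℚ._* (ℚ.1/ c)) ac≡0 ⟩
  0ℚ ℚ.* (ℚ.1/ c)          ≡⟨ ℚₚ.*-zeroˡ (ℚ.1/ c) ⟩
  0ℚ                       ∎
  where
  open ≡-Reasoning
  open +-*-Solver
  instance
    c-nonZero : ℚ.NonZero c
    c-nonZero = ℚ.≢-nonZero c≢0

-- Above degree `l`, multiplying `g` by the constant term contributes nothing, so the tail of the
-- first factor satisfies the same hypothesis and vanishes by induction; coefficient `l` of the
-- product is then `a` times the leading coefficient of `g`.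
degree-* : ∀ g l → IsTop g l → ∀ v → (∀ k → l ≤ k → coeff (v *ₚ g) k ≡ 0ℚ) → IsZero v
degree-* g l top         []      vg-low k = ≡.refl
degree-* g l (c≢0 , above) (a ∷ v) vg-low = λ { zero → a≡0 ; (suc k) → v≈0 k }
  where
  v≈0 : IsZero v
  v≈0 = degree-* g l (c≢0 , above) v λ k l≤k → begin
    coeff (v *ₚ g) k                                      ≡⟨ ℚₚ.+-identityˡ _ ⟨
    0ℚ ℚ.+ coeff (v *ₚ g) k                               ≡⟨ cong (ℚ._+ _) (≡.trans (cong (a ℚ.*_) (above (suc k) (s≤s l≤k))) (ℚₚ.*-zeroʳ a)) ⟨
    a ℚ.* coeff g (suc k) ℚ.+ coeff (v *ₚ g) k            ≡⟨ coeff-∷* a v g (suc k) ⟨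
    coeff ((a ∷ v) *ₚ g) (suc k)                          ≡⟨ vg-low (suc k) (ℕₚ.m≤n⇒m≤1+n l≤k) ⟩
    0ℚ                                                    ∎
    where open ≡-Reasoning
  a≡0 : a ≡ 0ℚ
  a≡0 = nonzero-cancel c≢0 (≡.trans (≡.sym (constant-* (a ∷ v) g (λ { (suc k) _ → v≈0 k }) l)) (vg-low l ℕₚ.≤-refl))

record Division (f r : ℚ[x]) (l : ℕ) : Set where
  field
    quotient remainder : ℚ[x]
    division  : f ≈ₚ (quotient *ₚ r) +ₚ remainder
    remainder-low : ∀ k → l ≤ k → coeff remainder k ≡ 0ℚ

-- Once `f = w r + s` is known, `a + x f = (x w) r + (a + x s)`, and the new remainder has degree at
-- most `l`; subtracting `t r` removes its coefficient at `l`.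
divide : ∀ f r l → IsTop r l → Division f r l
divide [] r l top = record { quotient = [] ; remainder = [] ; division = λ _ → ≡.refl ; remainder-low = λ _ _ → ≡.refl }
divide (a ∷ f) r l top@(c≢0 , above) = record
  { quotient = t ∷ w
  ; remainder = (a ∷ s) +ₚ map ((ℚ.- t) ℚ.*_) r
  ; division = λ k → ≡.sym (begin
      coeff (((t ∷ w) *ₚ r) +ₚ ((a ∷ s) +ₚ map ((ℚ.- t) ℚ.*_) r)) k
        ≡⟨ coeff-+ ((t ∷ w) *ₚ r) _ k ⟩
      coeff ((t ∷ w) *ₚ r) k ℚ.+ coeff ((a ∷ s) +ₚ map ((ℚ.- t) ℚ.*_) r) k
        ≡⟨ cong₂ ℚ._+_ (coeff-∷* t w r k) (coeff-rem k) ⟩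
      (t ℚ.* coeff r k ℚ.+ coeff (0ℚ ∷ (w *ₚ r)) k) ℚ.+ (coeff (a ∷ s) k ℚ.+ (ℚ.- t) ℚ.* coeff r k)
        ≡⟨ solve 4 (λ t c w s → (t :* c :+ w) :+ (s :+ (:- t) :* c) := w :+ s) ≡.refl t (coeff r k) (coeff (0ℚ ∷ (w *ₚ r)) k) (coeff (a ∷ s) k) ⟩
      coeff (0ℚ ∷ (w *ₚ r)) k ℚ.+ coeff (a ∷ s) k
        ≡⟨ shifted k ⟩
      coeff (a ∷ f) k ∎)
  ; remainder-low = low
  }
  where
  open ≡-Reasoning
  open +-*-Solver
  open Division (divide f r l top) renaming (quotient to w; remainder to s)
  c : ℚ
  c = coeff r l
  instance
    c-nonZero : ℚ.NonZero c
    c-nonZero = ℚ.≢-nonZero c≢0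
  t : ℚ
  t = coeff (a ∷ s) l ℚ.* (ℚ.1/ c)
  coeff-rem : ∀ k → coeff ((a ∷ s) +ₚ map ((ℚ.- t) ℚ.*_) r) k ≡ coeff (a ∷ s) k ℚ.+ (ℚ.- t) ℚ.* coeff r k
  coeff-rem k = ≡.trans (coeff-+ (a ∷ s) (map ((ℚ.- t) ℚ.*_) r) k) (cong (coeff (a ∷ s) k ℚ.+_) (coeff-scale (ℚ.- t) r k))
  shifted : ∀ k → coeff (0ℚ ∷ (w *ₚ r)) k ℚ.+ coeff (a ∷ s) k ≡ coeff (a ∷ f) k
  shifted zero    = ℚₚ.+-identityˡ a
  shifted (suc k) = ≡.trans (≡.sym (coeff-+ (w *ₚ r) s k)) (≡.sym (division k))
  low : ∀ k → l ≤ k → coeff ((a ∷ s) +ₚ map ((ℚ.- t) ℚ.*_) r) k ≡ 0ℚ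
  low k l≤k with ℕₚ.m≤n⇒m<n∨m≡n l≤k
  low .l _ | inj₂ ≡.refl = begin
    coeff ((a ∷ s) +ₚ map ((ℚ.- t) ℚ.*_) r) l   ≡⟨ coeff-rem l ⟩
    coeff (a ∷ s) l ℚ.+ (ℚ.- t) ℚ.* c           ≡⟨ cong (ℚ._+ (ℚ.- t) ℚ.* c) (*-inverseʳ-cancel (coeff (a ∷ s) l) c) ⟨
    t ℚ.* c ℚ.+ (ℚ.- t) ℚ.* c                   ≡⟨ solve 2 (λ t c → t :* c :+ (:- t) :* c := con 0ℚ) ≡.refl t c ⟩
    0ℚ                                          ∎
  low (suc k) _ | inj₁ (s≤s l≤k) = begin
    coeff ((a ∷ s) +ₚ map ((ℚ.- t) ℚ.*_) r) (suc k)   ≡⟨ coeff-rem (suc k) ⟩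
    coeff s k ℚ.+ (ℚ.- t) ℚ.* coeff r (suc k)         ≡⟨ cong₂ (λ x y → x ℚ.+ (ℚ.- t) ℚ.* y) (remainder-low k l≤k) (above (suc k) (s≤s l≤k)) ⟩
    0ℚ ℚ.+ (ℚ.- t) ℚ.* 0ℚ                             ≡⟨ ≡.trans (ℚₚ.+-identityˡ _) (ℚₚ.*-zeroʳ (ℚ.- t)) ⟩
    0ℚ                                                ∎

-- The field ℚ(α)

coeff-xⁿ : ∀ n → coeff (x^ n) n ≡ 1ℚ
coeff-xⁿ zero    = ≡.refl
coeff-xⁿ (suc n) = coeff-xⁿ n

coeff-xⁿ-above : ∀ n k → n < k → coeff (x^ n) k ≡ 0ℚ
coeff-xⁿ-above zero    (suc k) _         = ≡.refl
coeff-xⁿ-above (suc n) (suc k) (s≤s n<k) = coeff-xⁿ-above n k n<k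

x^-const-top : ∀ n b → 0 < n → coeff (x^ n -const b) n ≡ 1ℚ × IsTop (x^ n -const b) n
x^-const-top n@(suc _) b _ = top , (λ top≡0 → ℚₚ.1≢0 (≡.trans (≡.sym top) top≡0)) ,
  λ { k@(suc _) n<k → ≡.trans (coeff-+ (x^ n) (ℚ.- fromℤ b ∷ []) k) (≡.trans (ℚₚ.+-identityʳ _) (coeff-xⁿ-above n k n<k)) }
  where
  top : coeff (x^ n -const b) n ≡ 1ℚ
  top = ≡.trans (coeff-+ (x^ n) (ℚ.- fromℤ b ∷ []) n) (≡.trans (ℚₚ.+-identityʳ _) (coeff-xⁿ n))

module FieldExtension {c ℓ₁ ℓ₂} (L : FieldOverℚ c ℓ₁ ℓ₂) where
  open FieldOverℚ L using (ι; ι-isRingHomomorphism; heytingField; commutativeRing)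
  private
    module ι = IsRingHomomorphism ι-isRingHomomorphism

  asℤAlgebra : ℤAlgebra c ℓ₁
  asℤAlgebra = record
    { commutativeRing = commutativeRing
    ; κ = λ a → ι (fromℤ a)
    ; κ-isRingHomomorphism = Composition.isRingHomomorphism (CommutativeRing.trans commutativeRing) fromℤ-isRingHomomorphism ι-isRingHomomorphism
    }

  open ℤAlgebra asℤAlgebra

  1≉0 : ¬ 1# ≈ 0#
  1≉0 1≈0 = proj₂ (HeytingField.tight heytingField 1# 0#) 1≈0 (HeytingProperties.1#0 (HeytingField.heytingCommutativeRing heytingField))

  evalℤ≈ : ∀ p x → evalℤ L p x ≈ value p x
  evalℤ≈ []      x = refl
  evalℤ≈ (a ∷ p) x = +-congˡ (*-congˡ (evalℤ≈ p x))

  eval-+ : ∀ p q x → eval L (p +ₚ q) x ≈ eval L p x + eval L q x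
  eval-+ []      q       x = sym (+-identityˡ _)
  eval-+ (a ∷ p) []      x = sym (+-identityʳ _)
  eval-+ (a ∷ p) (c ∷ q) x = trans (+-cong (ι.+-homo a c) (*-congˡ (eval-+ p q x)))
    (solve 5 (λ a c x p q → (a :+ c) :+ x :* (p :+ q) := (a :+ x :* p) :+ (c :+ x :* q)) refl
      (ι a) (ι c) x (eval L p x) (eval L q x))
    where open Solver

  eval-scale : ∀ a p x → eval L (map (a ℚ.*_) p) x ≈ ι a * eval L p x
  eval-scale a []      x = sym (zeroʳ _)
  eval-scale a (c ∷ p) x = trans (+-cong (ι.*-homo a c) (*-congˡ (eval-scale a p x)))
    (solve 4 (λ a c x p → a :* c :+ x :* (a :* p) := a :* (c :+ x :* p)) refl (ι a) (ι c) x (eval L p x))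
    where open Solver

  eval-* : ∀ p q x → eval L (p *ₚ q) x ≈ eval L p x * eval L q x
  eval-* []      q x = sym (zeroˡ _)
  eval-* (a ∷ p) q x = trans (eval-+ (map (a ℚ.*_) q) _ x)
    (trans (+-cong (eval-scale a q x) (+-cong ι.0#-homo (*-congˡ (eval-* p q x))))
    (solve 4 (λ a x p q → a :* q :+ (con 0ℤ :+ x :* (p :* q)) := (a :+ x :* p) :* q) refl
      (ι a) x (eval L p x) (eval L q x)))
    where open Solver

  eval-zero : ∀ p x → IsZero p → eval L p x ≈ 0#
  eval-zero []      x p≈0 = refl
  eval-zero (a ∷ p) x p≈0 = trans
    (+-cong (trans (reflexive (cong ι (p≈0 0))) ι.0#-homo) (trans (*-congˡ (eval-zero p x (λ k → p≈0 (suc k)))) (zeroʳ x)))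
    (+-identityʳ 0#)

  eval-cong : ∀ p q x → p ≈ₚ q → eval L p x ≈ eval L q x
  eval-cong []      q       x p≈q = sym (eval-zero q x (λ k → ≡.sym (p≈q k)))
  eval-cong (a ∷ p) []      x p≈q = eval-zero (a ∷ p) x p≈q
  eval-cong (a ∷ p) (c ∷ q) x p≈q =
    +-cong (reflexive (cong ι (p≈q 0))) (*-congˡ (eval-cong p q x (λ k → p≈q (suc k))))

  eval-constant : ∀ a x → eval L (a ∷ []) x ≈ ι a
  eval-constant a x = trans (+-congˡ (zeroʳ x)) (+-identityʳ (ι a))

  eval-division : ∀ {f r l} (d : Division f r l) x → let open Division d in
                  eval L f x ≈ eval L quotient x * eval L r x + eval L remainder x
  eval-division {f} {r} d x = trans (eval-cong f ((quotient *ₚ r) +ₚ remainder) x division)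
    (trans (eval-+ (quotient *ₚ r) remainder x) (+-congʳ (eval-* quotient r x)))
    where open Division d

  eval-xⁿ : ∀ n x → eval L (x^ n) x ≈ x ^ n
  eval-xⁿ zero    x = trans (eval-constant 1ℚ x) ι.1#-homo
  eval-xⁿ (suc n) x = trans (+-cong ι.0#-homo (*-congˡ (eval-xⁿ n x))) (+-identityˡ _)

  module SimpleExtension (b : ℤ) (n : ℕ) (0<n : 0 < n)
                         (irreducible : Irreducibleℚ (x^ n -const b))
                         (α : Carrier) (root : IsRoot L (x^ n -const b) α) where

    private
      f : ℚ[x]
      f = x^ n -const b

    αⁿ≈b : α ^ n ≈ κ b
    αⁿ≈b = x∙y⁻¹≈ε⇒x≈y _ _ (begin
      α ^ n - κ b                                            ≈⟨ +-cong (eval-xⁿ n α) (trans (eval-constant (ℚ.- fromℤ b) α) (ι.-‿homo (fromℤ b))) ⟨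
      eval L (x^ n) α + eval L (ℚ.- fromℤ b ∷ []) α          ≈⟨ eval-+ (x^ n) (ℚ.- fromℤ b ∷ []) α ⟨
      eval L f α                                             ≈⟨ root ⟩
      0#                                                     ∎)
      where open ≈-Reasoning setoid

    Invertible : ℚ[x] → Set _
    Invertible p = ∃[ u ] eval L u α * eval L p α ≈ 1#

    0-noninvertible : ∀ p → eval L p α ≈ 0# → ¬ Invertible p
    0-noninvertible p p≈0 (u , up≈1) = 1≉0 (trans (sym up≈1) (trans (*-congˡ p≈0) (zeroʳ _)))

    factor-invertible : ∀ w r l → IsTop r l → l < n → f ≈ₚ w *ₚ r → Invertible r
    factor-invertible w r l r-top l<n f≈wr with Irreducible.split-∣1 irreducible {w} {r} f≈wr
    ... | inj₂ (u RawMagma., ur≈1) = u , (begin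
          eval L u α * eval L r α          ≈⟨ eval-* u r α ⟨
          eval L (u *ₚ r) α                ≈⟨ eval-cong (u *ₚ r) (1ℚ ∷ []) α ur≈1 ⟩
          eval L (1ℚ ∷ []) α               ≈⟨ eval-constant 1ℚ α ⟩
          ι 1ℚ                             ≈⟨ ι.1#-homo ⟩
          1#                               ∎)
      where open ≈-Reasoning setoid
    -- If `w` is a unit, it cannot have positive degree, since `degree-*` would make its inverse `u`
    -- vanish. A constant `w` is impossible as well: `f` would have degree below `n`.
    ... | inj₁ (u RawMagma., uw≈1) = ⊥-elim (ℚₚ.1≢0 (≡.trans (≡.sym (uw≈1 0)) (zero-* u w u≈0 0)))
      where
      constant-f : (∀ k → 0 < k → coeff w k ≡ 0ℚ) → ⊥
      constant-f w≈c = ℚₚ.1≢0 (begin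
        1ℚ                          ≡⟨ proj₁ (x^-const-top n b 0<n) ⟨
        coeff f n                   ≡⟨ f≈wr n ⟩
        coeff (w *ₚ r) n            ≡⟨ constant-* w r w≈c n ⟩
        coeff w 0 ℚ.* coeff r n     ≡⟨ cong (coeff w 0 ℚ.*_) (proj₂ r-top n l<n) ⟩
        coeff w 0 ℚ.* 0ℚ            ≡⟨ ℚₚ.*-zeroʳ (coeff w 0) ⟩
        0ℚ                          ∎)
        where open ≡-Reasoning
      u≈0 : IsZero u
      u≈0 with zero⊎top w
      ... | inj₁ w≈0 = ⊥-elim (constant-f (λ k _ → w≈0 k))
      ... | inj₂ (zero , _ , above) = ⊥-elim (constant-f above)
      ... | inj₂ (suc i , w-top) = degree-* w (suc i) w-top u λ { (suc k) _ → uw≈1 (suc k) }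

    -- A Euclidean descent without Bézout coefficients: divide `f` by `r` as `f = w r + s`. If `s`
    -- vanishes, `r` is a proper factor of `f`. Otherwise `0 = f(α)` reads `w(α) r(α) = - s(α)`, and
    -- an inverse `u(α)` of `s(α)` yields the inverse `- u(α) w(α)` of `r(α)`.
    top-invertible : ∀ l → ∀ r → IsTop r l → l < n → Invertible r
    top-invertible = <-rec _ λ l rec r r-top l<n → step l rec r r-top l<n (divide f r l r-top)
      where
      step : ∀ l → (∀ {k} → k < l → ∀ r → IsTop r k → k < n → Invertible r) →
             ∀ r → IsTop r l → l < n → Division f r l → Invertible r
      step l rec r r-top l<n d with zero⊎top (Division.remainder d)
      ... | inj₁ s≈0 = factor-invertible w r l r-top l<n λ k → ≡.trans (division k)
            (≡.trans (coeff-+ (w *ₚ r) s k) (≡.trans (cong (coeff (w *ₚ r) k ℚ.+_) (s≈0 k)) (ℚₚ.+-identityʳ _)))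
        where open Division d renaming (quotient to w; remainder to s)
      ... | inj₂ (m , s-top) = map (ℚ.- 1ℚ ℚ.*_) (u *ₚ w) , (begin
            eval L (map (ℚ.- 1ℚ ℚ.*_) (u *ₚ w)) α * R
              ≈⟨ *-congʳ (trans (eval-scale (ℚ.- 1ℚ) (u *ₚ w) α) (*-cong (trans (ι.-‿homo 1ℚ) (-‿cong ι.1#-homo)) (eval-* u w α))) ⟩
            - 1# * (U * W) * R
              ≈⟨ solve 4 (λ u w r s → :- con 1ℤ :* (u :* w) :* r := u :* s :+ :- (u :* (w :* r :+ s))) refl U W R S ⟩
            U * S - U * (W * R + S)
              ≈⟨ +-cong us≈1 (-‿cong (*-congˡ (trans (sym (eval-division d α)) root))) ⟩
            1# - U * 0#
              ≈⟨ solve 1 (λ u → con 1ℤ :+ :- (u :* con 0ℤ) := con 1ℤ) refl U ⟩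
            1# ∎)
        where
        open Division d renaming (quotient to w; remainder to s)
        m<l : m < l
        m<l with m ℕₚ.<? l
        ... | yes m<l = m<l
        ... | no  m≮l = ⊥-elim (proj₁ s-top (remainder-low m (ℕₚ.≮⇒≥ m≮l)))
        s-inv : Invertible s
        s-inv = rec m<l s s-top (ℕₚ.<-trans m<l l<n)
        u : ℚ[x]
        u = proj₁ s-inv
        us≈1 : eval L u α * eval L s α ≈ 1#
        us≈1 = proj₂ s-inv
        U W R S : Carrier
        U = eval L u α
        W = eval L w α
        R = eval L r α
        S = eval L s α
        open ≈-Reasoning setoid
        open Solver

    low-invertible : ∀ p → (∀ k → n ≤ k → coeff p k ≡ 0ℚ) → IsZero p ⊎ Invertible p
    low-invertible p low with zero⊎top p
    ... | inj₁ p≈0 = inj₁ p≈0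
    ... | inj₂ (l , p-top) = inj₂ (top-invertible l p p-top (ℕₚ.≰⇒> λ n≤l → proj₁ p-top (low l n≤l)))

    -- Equality in `L` need not be decidable; the decision is made on the rational coefficients of
    -- the remainder modulo `f`.
    zero⊎invertible : ∀ p → eval L p α ≈ 0# ⊎ Invertible p
    zero⊎invertible p = conclude (low-invertible remainder remainder-low)
      where
      open Division (divide p f n (proj₂ (x^-const-top n b 0<n)))
      p≈remainder : eval L p α ≈ eval L remainder α
      p≈remainder = trans (eval-division (divide p f n (proj₂ (x^-const-top n b 0<n))) α)
        (trans (+-congʳ (trans (*-congˡ root) (zeroʳ _))) (+-identityˡ _))
      conclude : IsZero remainder ⊎ Invertible remainder → eval L p α ≈ 0# ⊎ Invertible p
      conclude (inj₁ s≈0)         = inj₁ (trans p≈remainder (eval-zero remainder α s≈0))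
      conclude (inj₂ (u , us≈1)) = inj₂ (u , trans (*-congˡ p≈remainder) us≈1)

    -- Closure under inverses is the case that rests on irreducibility: the inverse of a polynomial
    -- value is again a polynomial value.
    ∈ℚ⟨α⟩⇒polynomial : ∀ {x} → ℚ⟨_⟩ L α x → ∃[ p ] x ≈ eval L p α
    ∈ℚ⟨α⟩⇒polynomial (scalar q) = q ∷ [] , sym (eval-constant q α)
    ∈ℚ⟨α⟩⇒polynomial gen = x^ 1 , sym (trans (eval-xⁿ 1 α) (*-identityʳ α))
    ∈ℚ⟨α⟩⇒polynomial (add x∈ y∈) with ∈ℚ⟨α⟩⇒polynomial x∈ | ∈ℚ⟨α⟩⇒polynomial y∈
    ... | p , x≈p | q , y≈q = p +ₚ q , trans (+-cong x≈p y≈q) (sym (eval-+ p q α))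
    ∈ℚ⟨α⟩⇒polynomial (neg {x} x∈) with ∈ℚ⟨α⟩⇒polynomial x∈
    ... | p , x≈p = map (ℚ.- 1ℚ ℚ.*_) p , (begin
      - x                                   ≈⟨ -‿cong x≈p ⟩
      - eval L p α                          ≈⟨ solve 1 (λ p → :- p := :- con 1ℤ :* p) refl (eval L p α) ⟩
      - 1# * eval L p α                     ≈⟨ *-congʳ (trans (ι.-‿homo 1ℚ) (-‿cong ι.1#-homo)) ⟨
      ι (ℚ.- 1ℚ) * eval L p α               ≈⟨ eval-scale (ℚ.- 1ℚ) p α ⟨
      eval L (map (ℚ.- 1ℚ ℚ.*_) p) α        ∎)
      where
      open ≈-Reasoning setoid
      open Solver
    ∈ℚ⟨α⟩⇒polynomial (mul x∈ y∈) with ∈ℚ⟨α⟩⇒polynomial x∈ | ∈ℚ⟨α⟩⇒polynomial y∈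
    ... | p , x≈p | q , y≈q = p *ₚ q , trans (*-cong x≈p y≈q) (sym (eval-* p q α))
    ∈ℚ⟨α⟩⇒polynomial (inv {x} {y} x∈ xy≈1) with ∈ℚ⟨α⟩⇒polynomial x∈
    ... | p , x≈p with zero⊎invertible p
    ...   | inj₁ p≈0        = ⊥-elim (1≉0 (trans (sym xy≈1) (trans (*-congʳ (trans x≈p p≈0)) (zeroˡ y))))
    ...   | inj₂ (u , up≈1) = u , (begin
      y                                     ≈⟨ *-identityˡ y ⟨
      1# * y                                ≈⟨ *-congʳ (trans (*-congˡ x≈p) up≈1) ⟨
      eval L u α * x * y                    ≈⟨ *-assoc _ x y ⟩
      eval L u α * (x * y)                  ≈⟨ trans (*-congˡ xy≈1) (*-identityʳ _) ⟩
      eval L u α                            ∎)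
      where open ≈-Reasoning setoid
    ∈ℚ⟨α⟩⇒polynomial (resp x≈y x∈) with ∈ℚ⟨α⟩⇒polynomial x∈
    ... | p , x≈p = p , trans (sym x≈y) x≈p

    -- A nonzero polynomial of degree below `n` has an invertible value at `α`. This turns equations
    -- in `α` into equations between coefficient vectors, which can then be read at any other root.
    linearly-independent : ∀ (v : Vec ℤ n) → value (toList v) α ≈ 0# → v ≡ Vec.replicate n 0ℤ
    linearly-independent v v≈0 with low-invertible (map fromℤ (toList v)) (coeff-long v)
      where
      coeff-long : ∀ {m} (v : Vec ℤ m) k → m ≤ k → coeff (map fromℤ (toList v)) k ≡ 0ℚ
      coeff-long []      k       _         = ≡.refl
      coeff-long (a ∷ v) (suc k) (s≤s m≤k) = coeff-long v k m≤k
    ... | inj₂ p-inv = ⊥-elim (0-noninvertible (map fromℤ (toList v)) (trans (evalℤ≈ (toList v) α) v≈0) p-inv)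
    ... | inj₁ p≈0   = all-zero v p≈0
      where
      all-zero : ∀ {m} (v : Vec ℤ m) → IsZero (map fromℤ (toList v)) → v ≡ Vec.replicate m 0ℤ
      all-zero []      _   = ≡.refl
      all-zero (a ∷ v) v≈0 = cong₂ _∷_ (fromℤ-injective (v≈0 0)) (all-zero v (λ k → v≈0 (suc k)))

-- Parity and denominators

parityℤ : ℤ → Parity
parityℤ i = ℕ.parity ℤ.∣ i ∣

private
  parity-suc : ∀ n → ℕ.parity (suc n) ≡ ℕ.parity n ℙ.⁻¹
  parity-suc zero          = ≡.refl
  parity-suc (suc zero)    = ≡.refl
  parity-suc (suc (suc n)) = parity-suc n

  parity-⊖ : ∀ m n → parityℤ (m ℤ.⊖ n) ≡ ℕ.parity m ℙ.+ ℕ.parity n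
  parity-⊖ m       zero    = ≡.sym (ℙₚ.+-identityʳ (ℕ.parity m))
  parity-⊖ zero    (suc n) = ≡.refl
  parity-⊖ (suc m) (suc n) = ≡.trans (cong parityℤ (ℤₚ.[1+m]⊖[1+n]≡m⊖n m n)) (≡.trans (parity-⊖ m n)
    (≡.trans (cancel (ℕ.parity m) (ℕ.parity n)) (≡.sym (cong₂ ℙ._+_ (parity-suc m) (parity-suc n)))))
    where
    cancel : ∀ p q → p ℙ.+ q ≡ p ℙ.⁻¹ ℙ.+ q ℙ.⁻¹
    cancel 0ℙ 0ℙ = ≡.refl
    cancel 0ℙ 1ℙ = ≡.refl
    cancel 1ℙ 0ℙ = ≡.refl
    cancel 1ℙ 1ℙ = ≡.refl

parityℤ-homo-+ : ∀ i j → parityℤ (i ℤ.+ j) ≡ parityℤ i ℙ.+ parityℤ j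
parityℤ-homo-+ (+ m)        (+ n)        = ℙₚ.+-homo-+ m n
parityℤ-homo-+ (+ m)        (ℤ.-[1+ n ]) = parity-⊖ m (suc n)
parityℤ-homo-+ (ℤ.-[1+ m ]) (+ n)        = ≡.trans (parity-⊖ n (suc m)) (ℙₚ.+-comm (ℕ.parity n) _)
parityℤ-homo-+ (ℤ.-[1+ m ]) (ℤ.-[1+ n ]) =
  ≡.trans (cong ℕ.parity (cong suc (≡.sym (ℕₚ.+-suc m n)))) (ℙₚ.+-homo-+ (suc m) (suc n))

parityℤ-homo-* : ∀ i j → parityℤ (i ℤ.* j) ≡ parityℤ i ℙ.* parityℤ j
parityℤ-homo-* i j = ≡.trans (cong ℕ.parity (ℤₚ.abs-* i j)) (ℙₚ.*-homo-* ℤ.∣ i ∣ ℤ.∣ j ∣)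

parityℤ-isRingHomomorphism : IsRingHomomorphism ℤ.+-*-rawRing (CommutativeRing.rawRing ℙₚ.+-*-commutativeRing) parityℤ
parityℤ-isRingHomomorphism = record
  { isSemiringHomomorphism = record
    { isNearSemiringHomomorphism = record
      { +-isMonoidHomomorphism = record
        { isMagmaHomomorphism = record
          { isRelHomomorphism = record { cong = cong parityℤ }
          ; homo = parityℤ-homo-+
          }
        ; ε-homo = ≡.refl
        }
      ; *-homo = parityℤ-homo-*
      }
    ; 1#-homo = ≡.refl
    }
  ; -‿homo = λ i → cong ℕ.parity (ℤₚ.∣-i∣≡∣i∣ i)
  }

parityAlgebra : ℤAlgebra 0ℓ 0ℓ
parityAlgebra = record
  { commutativeRing      = ℙₚ.+-*-commutativeRing
  ; κ                    = parityℤ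
  ; κ-isRingHomomorphism = parityℤ-isRingHomomorphism
  }

halve : ∀ n → (∃[ h ] n ≡ 2 ℕ.* h) ⊎ ℕ.parity n ≡ 1ℙ
halve zero          = inj₁ (0 , ≡.refl)
halve (suc zero)    = inj₂ ≡.refl
halve (suc (suc n)) with halve n
... | inj₁ (h , n≡2h) = inj₁ (suc h , ≡.trans (cong (λ m → suc (suc m)) n≡2h) (≡.sym (ℕₚ.*-suc 2 h)))
... | inj₂ odd        = inj₂ odd

-- Only the power of 2 in a denominator obstructs reduction at a prime above 2; the factor `s` has
-- residue 1 there.
record OddPart (d : ℤ) : Set where
  constructor oddPart
  field
    k   : ℕ
    s   : ℤ
    odd : parityℤ s ≡ 1ℙ
    d≡  : d ≡ (+ 2) ℤ.^ k ℤ.* s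

oddPart-ℕ : ∀ n → 0 < n → OddPart (+ n)
oddPart-ℕ = <-rec _ λ n rec 0<n → step n rec 0<n (halve n)
  where
  step : ∀ n → (∀ {m} → m < n → 0 < m → OddPart (+ m)) → 0 < n →
         (∃[ h ] n ≡ 2 ℕ.* h) ⊎ ℕ.parity n ≡ 1ℙ → OddPart (+ n)
  step n rec 0<n (inj₂ odd) = oddPart 0 (+ n) odd (≡.sym (ℤₚ.*-identityˡ (+ n)))
  step .(2 ℕ.* suc h) rec 0<n (inj₁ (suc h , ≡.refl)) with rec (ℕₚ.m<m+n (suc h) (s≤s z≤n)) (s≤s z≤n)
  ... | oddPart k s odd h≡ = oddPart (suc k) s odd
    (≡.trans (ℤₚ.pos-* 2 (suc h)) (≡.trans (cong (+ 2 ℤ.*_) h≡) (≡.sym (ℤₚ.*-assoc (+ 2) ((+ 2) ℤ.^ k) s))))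

oddPart-* : ∀ {d e} → OddPart d → OddPart e → OddPart (d ℤ.* e)
oddPart-* {d} {e} (oddPart k s s-odd d≡) (oddPart l t t-odd e≡) = oddPart (k ℕ.+ l) (s ℤ.* t)
  (≡.trans (parityℤ-homo-* s t) (cong₂ ℙ._*_ s-odd t-odd)) (begin
    d ℤ.* e                                                ≡⟨ cong₂ ℤ._*_ d≡ e≡ ⟩
    (2^ k ℤ.* s) ℤ.* (2^ l ℤ.* t)                          ≡⟨ solve 4 (λ a s b t → (a :* s) :* (b :* t) := (a :* b) :* (s :* t)) ≡.refl (2^ k) s (2^ l) t ⟩
    (2^ k ℤ.* 2^ l) ℤ.* (s ℤ.* t)                          ≡⟨ cong (ℤ._* (s ℤ.* t)) (ℤₚ.^-distribˡ-+-* (+ 2) k l) ⟨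
    2^ (k ℕ.+ l) ℤ.* (s ℤ.* t)                             ∎)
  where
  open ≡-Reasoning
  open ℤSolver
  2^_ : ℕ → ℤ
  2^ k = (+ 2) ℤ.^ k

numerator : ∀ q → fromℤ (ℚ.↧ q) ℚ.* q ≡ fromℤ (ℚ.↥ q)
numerator q@(ℚ.mkℚ n d-1 _) = ℚₚ.toℚᵘ-injective (ℚᵘₚ.≃-trans (ℚₚ.toℚᵘ-homo-* (fromℤ (ℚ.↧ q)) q)
  (ℚᵘₚ.≃-trans (ℚᵘₚ.*-congʳ (ℚₚ.toℚᵘ-fromℚᵘ (mkℚᵘ (ℚ.↧ q) 0)))
  (ℚᵘₚ.≃-trans (*≡* (≡.trans (ℤₚ.*-identityʳ (+ suc d-1 ℤ.* n)) (≡.trans (ℤₚ.*-comm (+ suc d-1) n) (cong (λ m → n ℤ.* + m) (≡.sym (ℕₚ.+-identityʳ (suc d-1))))))) (ℚᵘₚ.≃-sym (ℚₚ.toℚᵘ-fromℚᵘ (mkℚᵘ (ℚ.↥ q) 0))))))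

module _ {c ℓ₁ ℓ₂} (L : FieldOverℚ c ℓ₁ ℓ₂) where
  open FieldOverℚ L using (ι; ι-isRingHomomorphism)
  private module ι = IsRingHomomorphism ι-isRingHomomorphism
  open FieldExtension L
  open ℤAlgebra asℤAlgebra

  eval-scaleℤ : ∀ a p x → value (map (a ℤ.*_) p) x ≈ κ a * value p x
  eval-scaleℤ a []      x = sym (zeroʳ (κ a))
  eval-scaleℤ a (b ∷ p) x = trans (+-cong (κ-* a b) (*-congˡ (eval-scaleℤ a p x)))
    (solve 4 (λ a b x v → a :* b :+ x :* (a :* v) := a :* (b :+ x :* v)) refl (κ a) (κ b) x (value p x))
    where open Solver

  clear-denominators : ∀ p → ∃[ d ] ∃[ q ] OddPart d × (∀ x → κ d * eval L p x ≈ value q x)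
  clear-denominators []      = 1ℤ , [] , oddPart 0 1ℤ ≡.refl ≡.refl , λ x → zeroʳ _
  clear-denominators (a ∷ p) with clear-denominators p
  ... | d , q , d-odd , dp≈q = ℚ.↧ a ℤ.* d , d ℤ.* ℚ.↥ a ∷ map (ℚ.↧ a ℤ.*_) q ,
    oddPart-* (oddPart-ℕ (ℚ.↧ₙ a) (s≤s z≤n)) d-odd , λ x → begin
      κ (ℚ.↧ a ℤ.* d) * (ι a + x * eval L p x)            ≈⟨ *-congʳ (κ-* (ℚ.↧ a) d) ⟩
      κ (ℚ.↧ a) * κ d * (ι a + x * eval L p x)            ≈⟨ solve 5 (λ a d i x p → a :* d :* (i :+ x :* p) := d :* (a :* i) :+ x :* (a :* (d :* p))) refl (κ (ℚ.↧ a)) (κ d) (ι a) x (eval L p x) ⟩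
      κ d * (κ (ℚ.↧ a) * ι a) + x * (κ (ℚ.↧ a) * (κ d * eval L p x))
        ≈⟨ +-cong (*-congˡ (trans (sym (ι.*-homo (fromℤ (ℚ.↧ a)) a)) (reflexive (cong ι (numerator a))))) (*-congˡ (*-congˡ (dp≈q x))) ⟩
      κ d * κ (ℚ.↥ a) + x * (κ (ℚ.↧ a) * value q x)      ≈⟨ +-cong (κ-* d (ℚ.↥ a)) (*-congˡ (eval-scaleℤ (ℚ.↧ a) q x)) ⟨
      κ (d ℤ.* ℚ.↥ a) + x * value (map (ℚ.↧ a ℤ.*_) q) x ∎
    where
    open ≈-Reasoning setoid
    open Solver

-- Totally ramified extensions of ℤ at 2

module QuadraticExtension {c ℓ} (A : ℤAlgebra c ℓ) (δ : ℤAlgebra.Carrier A) where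
  private
    module A = ℤAlgebra A
    open A using (_+_; _*_; _≈_; 0#; 1#; +-cong; *-cong; *-congˡ)
    additive : AbelianGroup c ℓ
    additive = DirectProduct.abelianGroup A.+-abelianGroup A.+-abelianGroup
    open AbelianGroup additive using () renaming (Carrier to Pair; _≈_ to _≈²_)

    _*²_ : Pair → Pair → Pair
    (a , b) *² (c , d) = a * c + δ * (b * d) , a * d + b * c

    open A.Solver

  extensionRing : CommutativeRing c ℓ
  extensionRing = record
    { Carrier = Pair
    ; _≈_ = _≈²_
    ; _+_ = AbelianGroup._∙_ additive
    ; _*_ = _*²_
    ; -_  = AbelianGroup._⁻¹ additive
    ; 0#  = 0# , 0#
    ; 1#  = 1# , 0#
    ; isCommutativeRing = record
      { isRing = record
        { +-isAbelianGroup = AbelianGroup.isAbelianGroup additive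
        ; *-cong = λ (a≈ , b≈) (c≈ , d≈) →
            +-cong (*-cong a≈ c≈) (*-congˡ (*-cong b≈ d≈)) , +-cong (*-cong a≈ d≈) (*-cong b≈ c≈)
        ; *-assoc = λ (a , b) (c , d) (e , f) →
            solve 7 (λ a b c d e f z → (a :* c :+ z :* (b :* d)) :* e :+ z :* ((a :* d :+ b :* c) :* f)
                                    := a :* (c :* e :+ z :* (d :* f)) :+ z :* (b :* (c :* f :+ d :* e))) A.refl a b c d e f δ
          , solve 7 (λ a b c d e f z → (a :* c :+ z :* (b :* d)) :* f :+ (a :* d :+ b :* c) :* e
                                    := a :* (c :* f :+ d :* e) :+ b :* (c :* e :+ z :* (d :* f))) A.refl a b c d e f δ
        ; *-identity =
            (λ (a , b) → solve 3 (λ a b z → con 1ℤ :* a :+ z :* (con 0ℤ :* b) := a) A.refl a b δ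
                       , solve 2 (λ a b → con 1ℤ :* b :+ con 0ℤ :* a := b) A.refl a b)
          , (λ (a , b) → solve 3 (λ a b z → a :* con 1ℤ :+ z :* (b :* con 0ℤ) := a) A.refl a b δ
                       , solve 2 (λ a b → a :* con 0ℤ :+ b :* con 1ℤ := b) A.refl a b)
        ; distrib =
            (λ (a , b) (c , d) (e , f) →
              solve 7 (λ a b c d e f z → a :* (c :+ e) :+ z :* (b :* (d :+ f))
                := (a :* c :+ z :* (b :* d)) :+ (a :* e :+ z :* (b :* f))) A.refl a b c d e f δ
            , solve 6 (λ a b c d e f → a :* (d :+ f) :+ b :* (c :+ e)
                := (a :* d :+ b :* c) :+ (a :* f :+ b :* e)) A.refl a b c d e f)
          , (λ (a , b) (c , d) (e , f) →
              solve 7 (λ a b c d e f z → (c :+ e) :* a :+ z :* ((d :+ f) :* b)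
                := (c :* a :+ z :* (d :* b)) :+ (e :* a :+ z :* (f :* b))) A.refl a b c d e f δ
            , solve 6 (λ a b c d e f → (c :+ e) :* b :+ (d :+ f) :* a
                := (c :* b :+ d :* a) :+ (e :* b :+ f :* a)) A.refl a b c d e f)
        }
      ; *-comm = λ (a , b) (c , d) →
          solve 5 (λ a b c d z → a :* c :+ z :* (b :* d) := c :* a :+ z :* (d :* b)) A.refl a b c d δ
        , solve 4 (λ a b c d → a :* d :+ b :* c := c :* b :+ d :* a) A.refl a b c d
      }
    }

  inj : A.Carrier → Pair
  inj a = a , 0#

  inj-* : ∀ a b → inj (a * b) ≈² inj a *² inj b
  inj-* a b = solve 3 (λ a b z → a :* b := a :* b :+ z :* (con 0ℤ :* con 0ℤ)) A.refl a b δ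
            , solve 2 (λ a b → con 0ℤ := a :* con 0ℤ :+ con 0ℤ :* b) A.refl a b

  extension : ℤAlgebra c ℓ
  extension = record
    { commutativeRing = extensionRing
    ; κ = λ a → inj (A.κ a)
    ; κ-isRingHomomorphism = record
      { isSemiringHomomorphism = record
        { isNearSemiringHomomorphism = record
          { +-isMonoidHomomorphism = record
            { isMagmaHomomorphism = record
              { isRelHomomorphism = record { cong = λ a≡b → A.reflexive (cong A.κ a≡b) , A.refl }
              ; homo = λ a b → A.κ-+ a b , A.sym (A.+-identityˡ 0#)
              }
            ; ε-homo = A.κ-0 , A.refl
            }
          ; *-homo = λ a b → CommutativeRing.trans extensionRing (A.κ-* a b , A.refl) (inj-* (A.κ a) (A.κ b))
          }
        ; 1#-homo = A.κ-1 , A.refl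
        }
      ; -‿homo = λ a → A.κ-neg a , solve 0 (con 0ℤ := :- con 0ℤ) A.refl
      }
    }

  √δ : Pair
  √δ = 0# , 1#

  √δ² : √δ *² √δ ≈² inj δ
  √δ² = solve 1 (λ z → con 0ℤ :* con 0ℤ :+ z :* (con 1ℤ :* con 1ℤ) := z) A.refl δ
      , solve 0 (con 0ℤ :* con 1ℤ :+ con 1ℤ :* con 0ℤ := con 0ℤ) A.refl

  coordinates : ∀ a b → (a , b) ≈² AbelianGroup._∙_ additive (inj a) (inj b *² √δ)
  coordinates a b = solve 3 (λ a b z → a := a :+ (b :* con 0ℤ :+ z :* (con 0ℤ :* con 1ℤ))) A.refl a b δ
                  , solve 1 (λ b → b := con 0ℤ :+ (b :* con 1ℤ :+ con 0ℤ :* con 0ℤ)) A.refl b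

-- ℤ[ρ] with ρ^(2^s) = γ ≡ 3 (mod 4): the shift ρ - 1 is a root of an Eisenstein
-- polynomial at 2, so 2 is totally ramified, and ψ is reduction at the prime above 2.
record EisensteinRing (γ : ℤ) (s : ℕ) : Set₁ where
  field
    algebra : ℤAlgebra 0ℓ 0ℓ
  open ℤAlgebra algebra public
  field
    ρ         : Carrier
    ρ^2ˢ      : ρ ^ (2 ℕ.^ s) ≈ κ γ
    ψ         : Carrier → Parity
    ψ-cong    : ∀ {x y} → x ≈ y → ψ x ≡ ψ y
    ψ-+       : ∀ x y → ψ (x + y) ≡ ψ x ℙ.+ ψ y
    ψ-*       : ∀ x y → ψ (x * y) ≡ ψ x ℙ.* ψ y
    ψ-κ       : ∀ a → ψ (κ a) ≡ parityℤ a
    ψ-ρ       : ψ ρ ≡ 1ℙ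
    2-torsion : ∀ x → 2# * x ≈ 0# → x ≈ 0#

  π : Carrier
  π = ρ + κ (ℤ.- 1ℤ)

  field
    generated : ∀ x → ∃[ y ] ∃[ a ] x ≈ π * y + κ a
    ε         : Carrier
    ε-odd     : ψ ε ≡ 1ℙ
    ramified  : π ^ (2 ℕ.^ s) ≈ 2# * ε

  ψ-π : ψ π ≡ 0ℙ
  ψ-π = ≡.trans (ψ-+ ρ _) (cong₂ ℙ._+_ ψ-ρ (ψ-κ (ℤ.- 1ℤ)))

  ψ-2* : ∀ x → ψ (2# * x) ≡ 0ℙ
  ψ-2* x = ≡.trans (ψ-* 2# x) (cong (ℙ._* ψ x) (ψ-κ (+ 2)))

  ψ-^ : ∀ {x} n → ψ x ≡ 1ℙ → ψ (x ^ n) ≡ 1ℙ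
  ψ-^     zero    odd = ≡.trans (ψ-cong (sym κ-1)) (ψ-κ 1ℤ)
  ψ-^ {x} (suc n) odd = ≡.trans (ψ-* x (x ^ n)) (cong₂ ℙ._*_ odd (ψ-^ n odd))

  2-cancel : ∀ {x y} → 2# * x ≈ 2# * y → x ≈ y
  2-cancel {x} {y} eq = x∙y⁻¹≈ε⇒x≈y x y (2-torsion (x - y)
    (trans (solve 3 (λ t x y → t :* (x :- y) := t :* x :- t :* y) refl 2# x y) (x≈y⇒x∙y⁻¹≈ε eq)))
    where open Solver

  2^-cancel : ∀ n {x y} → 2# ^ n * x ≈ 2# ^ n * y → x ≈ y
  2^-cancel zero    {x} {y} eq = trans (sym (*-identityˡ x)) (trans eq (*-identityˡ y))
  2^-cancel (suc n) {x} {y} eq = 2^-cancel n (2-cancel (trans (sym (*-assoc 2# (2# ^ n) x)) (trans eq (*-assoc 2# (2# ^ n) y))))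

ℤ-algebra : ℤAlgebra 0ℓ 0ℓ
ℤ-algebra = record
  { commutativeRing      = ℤₚ.+-*-commutativeRing
  ; κ                    = λ a → a
  ; κ-isRingHomomorphism = Identity.isRingHomomorphism ℤ.+-*-rawRing ≡.refl
  }

module _ (j : ℤ) where
  private
    γ : ℤ
    γ = + 4 ℤ.* j ℤ.+ + 3
    open ℤSolver

  ℤ-EisensteinRing : EisensteinRing γ 0
  ℤ-EisensteinRing = record
    { algebra   = ℤ-algebra
    ; ρ         = γ
    ; ρ^2ˢ      = ℤₚ.*-identityʳ γ
    ; ψ         = parityℤ
    ; ψ-cong    = cong parityℤ
    ; ψ-+       = parityℤ-homo-+
    ; ψ-*       = parityℤ-homo-*
    ; ψ-κ       = λ _ → ≡.refl
    ; ψ-ρ       = ≡.trans (parityℤ-homo-+ (+ 4 ℤ.* j) (+ 3)) (cong (ℙ._+ 1ℙ) (parityℤ-homo-* (+ 4) j))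
    ; 2-torsion = λ x 2x≡0 → ℤₚ.*-cancelˡ-≡ (+ 2) x 0ℤ 2x≡0
    ; generated = λ x → 0ℤ , x , solve 2 (λ p x → x := p :* con 0ℤ :+ x) ≡.refl (γ ℤ.+ ℤ.- 1ℤ) x
    -- For `s = 0` the root is `γ` itself and `π = γ - 1 = 4 j + 2` is twice an odd number, because
    -- `γ ≡ 3 (mod 4)`.
    ; ε         = + 2 ℤ.* j ℤ.+ 1ℤ
    ; ε-odd     = ≡.trans (parityℤ-homo-+ (+ 2 ℤ.* j) 1ℤ) (cong (ℙ._+ 1ℙ) (parityℤ-homo-* (+ 2) j))
    ; ramified  = solve 1 (λ j → (con (+ 4) :* j :+ con (+ 3) :+ con (ℤ.- 1ℤ)) :* con 1ℤ
                                := con (+ 2) :* (con (+ 2) :* j :+ con 1ℤ)) ≡.refl j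
    }

module _ {c ℓ} (A : ℤAlgebra c ℓ) where
  open ℤAlgebra A

  binomial-remainder : ∀ x y n → ∃[ t ] (x + y) ^ n ≈ x ^ n + y * t
  binomial-remainder x y zero    = 0# , solve 1 (λ y → con 1ℤ := con 1ℤ :+ y :* con 0ℤ) refl y
    where open Solver
  binomial-remainder x y (suc n) with binomial-remainder x y n
  ... | t , eq = x ^ n + (x + y) * t , trans (*-congˡ eq)
    (solve 4 (λ x y p t → (x :+ y) :* (p :+ y :* t) := x :* p :+ y :* (p :+ (x :+ y) :* t)) refl x y (x ^ n) t)
    where open Solver

-- The ring B = E[r] with r² = ρ, described by its embedding inj : E → B.
module SquareRoot {γ s} (E : EisensteinRing γ s) (B : ℤAlgebra 0ℓ 0ℓ)
  (inj      : EisensteinRing.Carrier E → ℤAlgebra.Carrier B)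
  (inj-cong : ∀ {a b} → EisensteinRing._≈_ E a b → ℤAlgebra._≈_ B (inj a) (inj b))
  (inj-+    : ∀ a b → ℤAlgebra._≈_ B (inj (EisensteinRing._+_ E a b)) (ℤAlgebra._+_ B (inj a) (inj b)))
  (inj-*    : ∀ a b → ℤAlgebra._≈_ B (inj (EisensteinRing._*_ E a b)) (ℤAlgebra._*_ B (inj a) (inj b)))
  (inj-κ    : ∀ a → ℤAlgebra._≈_ B (inj (EisensteinRing.κ E a)) (ℤAlgebra.κ B a))
  (r        : ℤAlgebra.Carrier B)
  (r²       : ℤAlgebra._≈_ B (ℤAlgebra._*_ B r r) (inj (EisensteinRing.ρ E)))
  where
  private module E = EisensteinRing E
  open ℤAlgebra B
  open ≈-Reasoning setoid
  open Solver

  private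
    M : ℕ
    M = 2 ℕ.^ s

  inj-^ : ∀ a n → inj (a E.^ n) ≈ inj a ^ n
  inj-^ a zero    = trans (inj-cong (E.sym E.κ-1)) (trans (inj-κ 1ℤ) κ-1)
  inj-^ a (suc n) = trans (inj-* a (a E.^ n)) (*-congˡ (inj-^ a n))

  r^2ˢ⁺¹ : r ^ (2 ℕ.^ suc s) ≈ κ γ
  r^2ˢ⁺¹ = begin
    r ^ (2 ℕ.^ suc s)    ≈⟨ ^-assocʳ r 2 M ⟨
    (r ^ 2) ^ M          ≈⟨ ^-congˡ M (trans (*-congˡ (*-identityʳ r)) r²) ⟩
    inj E.ρ ^ M          ≈⟨ inj-^ E.ρ M ⟨
    inj (E.ρ E.^ M)      ≈⟨ trans (inj-cong E.ρ^2ˢ) (inj-κ γ) ⟩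
    κ γ                  ∎

  πᵣ : Carrier
  πᵣ = r + κ (ℤ.- 1ℤ)

  -- ρ - 1 = (r - 1)(r + 1)
  inj-π : inj E.π ≈ πᵣ * (r + 1#)
  inj-π = begin
    inj E.π                              ≈⟨ trans (inj-+ E.ρ _) (+-cong (sym r²) (inj-κ (ℤ.- 1ℤ))) ⟩
    r * r + κ (ℤ.- 1ℤ)                   ≈⟨ solve 1 (λ r → r :* r :+ con (ℤ.- 1ℤ) := (r :+ con (ℤ.- 1ℤ)) :* (r :+ con 1ℤ)) refl r ⟩
    πᵣ * (r + 1#)                        ∎

  -- Both coordinates are integers modulo `π`, which is a multiple of `πᵣ`, and `r = πᵣ + 1`
  -- replaces `n r` by `n` modulo `πᵣ`.
  generatedᵣ : ∀ a b → ∃[ y ] ∃[ m ] inj a + inj b * r ≈ πᵣ * y + κ m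
  generatedᵣ a b with E.generated a | E.generated b
  ... | y , m , a≈ | z , n , b≈ = (r + 1#) * (inj y + inj z * r) + κ n , m ℤ.+ n , (begin
      inj a + inj b * r                                        ≈⟨ +-cong (split a≈) (*-congʳ (split b≈)) ⟩
      (πᵣ * (r + 1#) * inj y + κ m) + (πᵣ * (r + 1#) * inj z + κ n) * r
        ≈⟨ solve 5 (λ r y z m n → ((r :+ con (ℤ.- 1ℤ)) :* (r :+ con 1ℤ) :* y :+ m) :+ ((r :+ con (ℤ.- 1ℤ)) :* (r :+ con 1ℤ) :* z :+ n) :* r
              := (r :+ con (ℤ.- 1ℤ)) :* ((r :+ con 1ℤ) :* (y :+ z :* r) :+ n) :+ (m :+ n)) refl r (inj y) (inj z) (κ m) (κ n) ⟩
      πᵣ * ((r + 1#) * (inj y + inj z * r) + κ n) + (κ m + κ n)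
        ≈⟨ +-congˡ (κ-+ m n) ⟨
      πᵣ * ((r + 1#) * (inj y + inj z * r) + κ n) + κ (m ℤ.+ n) ∎)
    where
    split : ∀ {a y m} → a E.≈ E.π E.* y E.+ E.κ m → inj a ≈ πᵣ * (r + 1#) * inj y + κ m
    split {a} {y} {m} eq = trans (inj-cong eq) (trans (inj-+ (E.π E.* y) (E.κ m))
      (+-cong (trans (inj-* E.π y) (*-congʳ inj-π)) (inj-κ m)))

  d : Carrier
  d = κ (ℤ.- 1ℤ) * πᵣ

  -- (r - 1)² = (ρ - 1) - 2 (r - 1)
  πᵣ² : πᵣ ^ 2 ≈ inj E.π + 2# * d
  πᵣ² = trans (solve 1 (λ r → (r :+ con (ℤ.- 1ℤ)) :* ((r :+ con (ℤ.- 1ℤ)) :* con 1ℤ)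
      := (r :+ con (ℤ.- 1ℤ)) :* (r :+ con 1ℤ) :+ con (+ 2) :* (con (ℤ.- 1ℤ) :* (r :+ con (ℤ.- 1ℤ)))) refl r)
    (+-congʳ (sym inj-π))

  t : Carrier
  t = proj₁ (binomial-remainder B (inj E.π) (2# * d) M)

  -- As `πᵣ²` is the old `π` up to `2 d`, its `M`-th power is `π^M = 2 ε` up to a multiple of `2 d`.
  -- The factor `d = - πᵣ` has residue 0, so the new cofactor of 2 keeps residue 1.
  ramifiedᵣ : πᵣ ^ (2 ℕ.^ suc s) ≈ 2# * (inj E.ε + d * t)
  ramifiedᵣ = begin
    πᵣ ^ (2 ℕ.^ suc s)                      ≈⟨ ^-assocʳ πᵣ 2 M ⟨
    (πᵣ ^ 2) ^ M                            ≈⟨ ^-congˡ M πᵣ² ⟩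
    (inj E.π + 2# * d) ^ M                  ≈⟨ proj₂ (binomial-remainder B (inj E.π) (2# * d) M) ⟩
    inj E.π ^ M + 2# * d * t                ≈⟨ +-cong (trans (sym (inj-^ E.π M)) (trans (inj-cong E.ramified)
                                                 (trans (inj-* E.2# E.ε) (*-congʳ (inj-κ (+ 2)))))) (*-assoc 2# d t) ⟩
    2# * inj E.ε + 2# * (d * t)             ≈⟨ distribˡ 2# (inj E.ε) _ ⟨
    2# * (inj E.ε + d * t)                  ∎

adjoin-√ρ : ∀ {γ s} → EisensteinRing γ s → EisensteinRing γ (suc s)
adjoin-√ρ {γ} {s} E = record
  { algebra   = extension
  ; ρ         = √δ
  ; ρ^2ˢ      = Q.r^2ˢ⁺¹
  ; ψ         = ψ
  ; ψ-cong    = λ (a≈ , b≈) → cong₂ ℙ._+_ (E.ψ-cong a≈) (E.ψ-cong b≈)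
  ; ψ-+       = ψ-+
  ; ψ-*       = ψ-*
  ; ψ-κ       = ψ-κ
  ; ψ-ρ       = cong₂ ℙ._+_ ψ0 ψ1
  ; 2-torsion = λ (a , b) (2a≈0 , 2b≈0) →
      E.2-torsion a (E.trans (solve 4 (λ t a b r → t :* a := t :* a :+ r :* (con 0ℤ :* b)) E.refl E.2# a b E.ρ) 2a≈0)
    , E.2-torsion b (E.trans (solve 3 (λ t a b → t :* b := t :* b :+ con 0ℤ :* a) E.refl E.2# a b) 2b≈0)
  ; generated = λ (a , b) → proj₁ (Q.generatedᵣ a b) , proj₁ (proj₂ (Q.generatedᵣ a b)) ,
      B.trans (coordinates a b) (proj₂ (proj₂ (Q.generatedᵣ a b)))
  ; ε         = inj E.ε B.+ Q.d B.* Q.t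
  ; ε-odd     = ε-odd
  ; ramified  = Q.ramifiedᵣ
  }
  where
  module E = EisensteinRing E
  open QuadraticExtension E.algebra E.ρ
  module B = ℤAlgebra extension
  module ℙₛ = ℤAlgebra.Solver parityAlgebra
  open E.Solver
  module Q = SquareRoot E extension inj (λ eq → eq , E.refl) (λ _ _ → E.refl , E.sym (E.+-identityˡ E.0#)) inj-* (λ _ → E.refl , E.refl) √δ √δ²
  -- The new root must have residue 1, since its square `ρ` has; hence `a + b √ρ` has the residue of
  -- `a + b`.
  ψ : B.Carrier → Parity
  ψ (a , b) = E.ψ a ℙ.+ E.ψ b

  ψ-+ : ∀ x y → ψ (x B.+ y) ≡ ψ x ℙ.+ ψ y
  ψ-+ (a , b) (c , d) = ≡.trans (cong₂ ℙ._+_ (E.ψ-+ a c) (E.ψ-+ b d))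
    (ℙₛ.solve 4 (λ a b c d → (a ℙₛ.:+ c) ℙₛ.:+ (b ℙₛ.:+ d) ℙₛ.:= (a ℙₛ.:+ b) ℙₛ.:+ (c ℙₛ.:+ d)) ≡.refl (E.ψ a) (E.ψ b) (E.ψ c) (E.ψ d))

  ψ-* : ∀ x y → ψ (x B.* y) ≡ ψ x ℙ.* ψ y
  ψ-* (a , b) (c , d) = ≡.trans
    (cong₂ ℙ._+_ (≡.trans (E.ψ-+ _ _) (cong₂ ℙ._+_ (E.ψ-* a c)
                   (≡.trans (E.ψ-* E.ρ _) (cong₂ ℙ._*_ E.ψ-ρ (E.ψ-* b d)))))
                 (≡.trans (E.ψ-+ _ _) (cong₂ ℙ._+_ (E.ψ-* a d) (E.ψ-* b c))))
    (ℙₛ.solve 4 (λ a b c d → (a ℙₛ.:* c ℙₛ.:+ b ℙₛ.:* d) ℙₛ.:+ (a ℙₛ.:* d ℙₛ.:+ b ℙₛ.:* c)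
                          ℙₛ.:= (a ℙₛ.:+ b) ℙₛ.:* (c ℙₛ.:+ d)) ≡.refl (E.ψ a) (E.ψ b) (E.ψ c) (E.ψ d))

  ψ0 : E.ψ E.0# ≡ 0ℙ
  ψ0 = ≡.trans (E.ψ-cong (E.sym E.κ-0)) (E.ψ-κ 0ℤ)

  ψ1 : E.ψ E.1# ≡ 1ℙ
  ψ1 = ≡.trans (E.ψ-cong (E.sym E.κ-1)) (E.ψ-κ 1ℤ)

  ψ-κ : ∀ a → ψ (B.κ a) ≡ parityℤ a
  ψ-κ a = ≡.trans (cong₂ ℙ._+_ (E.ψ-κ a) ψ0) (ℙₚ.+-identityʳ _)

  ε-odd : ψ (inj E.ε B.+ Q.d B.* Q.t) ≡ 1ℙ
  ε-odd = begin
    ψ (inj E.ε B.+ Q.d B.* Q.t)                                  ≡⟨ ψ-+ (inj E.ε) (Q.d B.* Q.t) ⟩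
    (E.ψ E.ε ℙ.+ E.ψ E.0#) ℙ.+ ψ (Q.d B.* Q.t)                   ≡⟨ cong₂ ℙ._+_ (cong₂ ℙ._+_ E.ε-odd ψ0) (≡.trans (ψ-* Q.d Q.t) (cong (ℙ._* ψ Q.t) ψ-d)) ⟩
    1ℙ                                                           ∎
    where
    open ≡-Reasoning
    ψ-d : ψ Q.d ≡ 0ℙ
    ψ-d = ≡.trans (ψ-* (B.κ (ℤ.- 1ℤ)) Q.πᵣ) (≡.trans (cong (ℙ._* ψ Q.πᵣ) (ψ-κ (ℤ.- 1ℤ)))
      (≡.trans (ψ-+ √δ (B.κ (ℤ.- 1ℤ))) (cong₂ ℙ._+_ (cong₂ ℙ._+_ ψ0 ψ1) (ψ-κ (ℤ.- 1ℤ)))))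

eisensteinRing : ∀ j s → EisensteinRing (+ 4 ℤ.* j ℤ.+ + 3) s
eisensteinRing j zero    = ℤ-EisensteinRing j
eisensteinRing j (suc s) = adjoin-√ρ (eisensteinRing j s)

0ℙ≢1ℙ : 0ℙ ≢ 1ℙ
0ℙ≢1ℙ ()

even⇒double : ∀ a → parityℤ a ≡ 0ℙ → ∃[ h ] a ≡ + 2 ℤ.* h
even⇒double a even with halve ℤ.∣ a ∣
... | inj₂ odd = ⊥-elim (0ℙ≢1ℙ (≡.trans (≡.sym even) odd))
even⇒double (+ n)      _ | inj₁ (h , n≡2h)  = + h , ≡.trans (cong +_ n≡2h) (ℤₚ.pos-* 2 h)
even⇒double ℤ.-[1+ n ] _ | inj₁ (h , sn≡2h) = ℤ.- + h ,
  ≡.trans (cong (λ m → ℤ.- + m) sn≡2h) (≡.trans (cong ℤ.-_ (ℤₚ.pos-* 2 h)) (ℤₚ.neg-distribʳ-* (+ 2) (+ h)))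

-- The valuation at the prime above 2 and integral closure

module Valuation {γ s} (E : EisensteinRing γ s) where
  open EisensteinRing E
  open ≈-Reasoning setoid
  open Solver

  private
    M : ℕ
    M = 2 ℕ.^ s

  -- The prime above 2 is generated by `π` and 2: modulo `π` every element is an integer, and the
  -- residue is its parity.
  kernel : ∀ z → ψ z ≡ 0ℙ → ∃[ y ] ∃[ w ] z ≈ π * y + 2# * w
  kernel z even with generated z
  ... | y , a , z≈ with even⇒double a (≡.sym (≡.trans (≡.sym even) (≡.trans (ψ-cong z≈) (≡.trans (ψ-+ (π * y) (κ a))
          (cong₂ ℙ._+_ (≡.trans (ψ-* π y) (cong (ℙ._* ψ y) ψ-π)) (ψ-κ a))))))
  ...   | h , a≡2h = y , κ h , trans z≈ (+-congˡ (trans (reflexive (cong κ a≡2h)) (κ-* (+ 2) h)))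

  -- Successive factors `π` are split off by `kernel` until an odd cofactor appears or `l` of them
  -- have been found; the multiples of 2 arising on the way are collected in `w`.
  π-adic : ∀ q l → (∃[ w ] ∃[ z ] q ≈ 2# * w + π ^ l * z) ⊎
                   (∃[ j ] ∃[ w ] ∃[ z ] j < l × q ≈ 2# * w + π ^ j * z × ψ z ≡ 1ℙ)
  π-adic q zero = inj₁ (0# , q , solve 2 (λ t q → q := t :* con 0ℤ :+ con 1ℤ :* q) refl 2# q)
  π-adic q (suc l) with π-adic q l
  ... | inj₂ (j , w , z , j<l , eq , odd) = inj₂ (j , w , z , ℕₚ.m≤n⇒m≤1+n j<l , eq , odd)
  ... | inj₁ (w , z , q≈) with ψ z in parity-z
  ...   | 1ℙ = inj₂ (l , w , z , ℕₚ.≤-refl , q≈ , parity-z)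
  ...   | 0ℙ with kernel z parity-z
  ...     | y , v , z≈ = inj₁ (w + π ^ l * v , y , trans q≈ (trans (+-congˡ (*-congˡ z≈))
    (solve 6 (λ t w p l v y → t :* w :+ l :* (p :* y :+ t :* v) := t :* (w :+ l :* v) :+ (p :* l) :* y) refl 2# w π (π ^ l) v y)))

  -- Either `q` is divisible by `π^M` modulo 2, hence by 2, or its leading term is `π^j z` with
  -- `j < M`. Multiplication by `π^(M - j)` turns that term into `2 ε z`; since `M - j` is positive,
  -- the other term contributes residue 0 to `u`.
  even⊎odd-valuation : ∀ q → (∃[ w ] q ≈ 2# * w) ⊎ (∃[ i ] ∃[ u ] π ^ suc i * q ≈ 2# * u × ψ u ≡ 1ℙ)
  even⊎odd-valuation q with π-adic q M
  ... | inj₁ (w , z , q≈) = inj₁ (w + ε * z , trans q≈ (trans (+-congˡ (*-congʳ ramified))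
    (solve 4 (λ t w e z → t :* w :+ (t :* e) :* z := t :* (w :+ e :* z)) refl 2# w ε z)))
  ... | inj₂ (j , w , z , j<M , q≈ , odd) = inj₂ (i , π ^ suc i * w + ε * z , (begin
      π ^ suc i * q                                    ≈⟨ *-congˡ q≈ ⟩
      π ^ suc i * (2# * w + π ^ j * z)                 ≈⟨ solve 5 (λ p t w l z → p :* (t :* w :+ l :* z) := t :* (p :* w) :+ (p :* l) :* z) refl (π ^ suc i) 2# w (π ^ j) z ⟩
      2# * (π ^ suc i * w) + π ^ suc i * π ^ j * z     ≈⟨ +-congˡ (*-congʳ (trans (sym (^-homo-* π (suc i) j)) (trans (^-congʳ π i+j≡M) ramified))) ⟩
      2# * (π ^ suc i * w) + 2# * ε * z                ≈⟨ solve 4 (λ t w e z → t :* w :+ t :* e :* z := t :* (w :+ e :* z)) refl 2# (π ^ suc i * w) ε z ⟩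
      2# * (π ^ suc i * w + ε * z)                     ∎) ,
      ≡.trans (ψ-+ (π ^ suc i * w) (ε * z)) (cong₂ ℙ._+_
        (≡.trans (ψ-* (π ^ suc i) w) (cong (ℙ._* ψ w) (≡.trans (ψ-* π (π ^ i)) (cong (ℙ._* ψ (π ^ i)) ψ-π))))
        (≡.trans (ψ-* ε z) (cong₂ ℙ._*_ ε-odd odd))))
    where
    i : ℕ
    i = M ℕ.∸ suc j
    i+j≡M : suc i ℕ.+ j ≡ M
    i+j≡M = ≡.trans (≡.sym (ℕₚ.+-suc i j)) (ℕₚ.m∸n+n≡m j<M)

  -- If q/2ᵏ has powers with bounded denominators then it lies in the ring: otherwise
  -- πʲ q = 2 u with ψ(u) = 1 and j ≥ 1, and the (m (e + 1))-th power of this relation has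
  -- more factors of 2 on the left than on the right.
  integrally-closed : ∀ e σ → ψ σ ≡ 1ℙ → ∀ k q h →
    2# ^ e * σ * q ^ (M ℕ.* suc e) ≈ 2# ^ (k ℕ.* (M ℕ.* suc e)) * h → ∃[ q′ ] q ≈ 2# ^ k * q′
  integrally-closed e σ σ-odd zero    q h eq = q , sym (*-identityˡ q)
  integrally-closed e σ σ-odd (suc k) q h eq with even⊎odd-valuation q
  ... | inj₁ (w , q≈2w) = q′ , trans q≈2w (trans (*-congˡ w≈) (sym (*-assoc 2# (2# ^ k) q′)))
    where
    N : ℕ
    N = M ℕ.* suc e
    IH : ∃[ q′ ] w ≈ 2# ^ k * q′
    IH = integrally-closed e σ σ-odd k w h (2^-cancel N (begin
      2# ^ N * (2# ^ e * σ * w ^ N)        ≈⟨ solve 4 (λ n a s w → n :* (a :* s :* w) := a :* s :* (n :* w)) refl (2# ^ N) (2# ^ e) σ (w ^ N) ⟩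
      2# ^ e * σ * (2# ^ N * w ^ N)        ≈⟨ *-congˡ (trans (sym (^-distrib-* 2# w N)) (^-congˡ N (sym q≈2w))) ⟩
      2# ^ e * σ * q ^ N                   ≈⟨ eq ⟩
      2# ^ (N ℕ.+ k ℕ.* N) * h             ≈⟨ trans (*-congʳ (^-homo-* 2# N (k ℕ.* N))) (*-assoc _ _ h) ⟩
      2# ^ N * (2# ^ (k ℕ.* N) * h)        ∎))
    q′ : Carrier
    q′ = proj₁ IH
    w≈ : w ≈ 2# ^ k * q′
    w≈ = proj₂ IH
  ... | inj₂ (i , u , πq≈2u , u-odd) = ⊥-elim (0ℙ≢1ℙ (≡.trans (≡.sym (ψ-2* _)) (≡.trans (≡.sym (ψ-cong odd≈even)) odd)))
    where
    N x : ℕ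
    N = M ℕ.* suc e
    x = i ℕ.* suc e
    odd : ψ (σ * u ^ N) ≡ 1ℙ
    odd = ≡.trans (ψ-* σ (u ^ N)) (cong₂ ℙ._*_ σ-odd (ψ-^ N u-odd))
    -- The exponent `N` is made for this: `(i + 1) N` is `M` times `(i + 1)(e + 1) = e + 1 + x`, so
    -- at least `e + 1` factors of 2 appear, one more than `2# ^ e` can cancel.
    π-power : (π ^ suc i) ^ N ≈ 2# * 2# ^ e * 2# ^ x * ε ^ (suc e ℕ.+ x)
    π-power = begin
      (π ^ suc i) ^ N                            ≈⟨ ^-assocʳ π (suc i) N ⟩
      π ^ (suc i ℕ.* (M ℕ.* suc e))              ≈⟨ ^-congʳ π (≡.trans (≡.sym (ℕₚ.*-assoc (suc i) M (suc e)))
                                                      (≡.trans (cong (ℕ._* suc e) (ℕₚ.*-comm (suc i) M)) (ℕₚ.*-assoc M (suc i) (suc e)))) ⟩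
      π ^ (M ℕ.* (suc e ℕ.+ x))                  ≈⟨ ^-assocʳ π M (suc e ℕ.+ x) ⟨
      (π ^ M) ^ (suc e ℕ.+ x)                    ≈⟨ ^-congˡ (suc e ℕ.+ x) ramified ⟩
      (2# * ε) ^ (suc e ℕ.+ x)                   ≈⟨ ^-distrib-* 2# ε (suc e ℕ.+ x) ⟩
      2# ^ (suc e ℕ.+ x) * ε ^ (suc e ℕ.+ x)     ≈⟨ *-congʳ (^-homo-* 2# (suc e) x) ⟩
      2# * 2# ^ e * 2# ^ x * ε ^ (suc e ℕ.+ x)   ∎
    odd≈even : σ * u ^ N ≈ 2# * (2# ^ x * ε ^ (suc e ℕ.+ x) * (2# ^ (k ℕ.* N) * h))
    odd≈even = 2^-cancel N (2^-cancel e (begin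
      2# ^ e * (2# ^ N * (σ * u ^ N))            ≈⟨ solve 4 (λ a n s u → a :* (n :* (s :* u)) := a :* s :* (n :* u)) refl (2# ^ e) (2# ^ N) σ (u ^ N) ⟩
      2# ^ e * σ * (2# ^ N * u ^ N)              ≈⟨ *-congˡ (trans (sym (^-distrib-* 2# u N)) (trans (^-congˡ N (sym πq≈2u)) (^-distrib-* (π ^ suc i) q N))) ⟩
      2# ^ e * σ * ((π ^ suc i) ^ N * q ^ N)     ≈⟨ solve 4 (λ a s p q → a :* s :* (p :* q) := p :* (a :* s :* q)) refl (2# ^ e) σ ((π ^ suc i) ^ N) (q ^ N) ⟩
      (π ^ suc i) ^ N * (2# ^ e * σ * q ^ N)     ≈⟨ *-cong π-power (trans eq (*-congʳ (^-homo-* 2# N (k ℕ.* N)))) ⟩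
      2# * 2# ^ e * 2# ^ x * ε ^ (suc e ℕ.+ x) * (2# ^ N * 2# ^ (k ℕ.* N) * h)
        ≈⟨ solve 7 (λ t a x ε n k h → t :* a :* x :* ε :* (n :* k :* h) := a :* (n :* (t :* (x :* ε :* (k :* h))))) refl
             2# (2# ^ e) (2# ^ x) (ε ^ (suc e ℕ.+ x)) (2# ^ N) (2# ^ (k ℕ.* N)) h ⟩
      2# ^ e * (2# ^ N * (2# * (2# ^ x * ε ^ (suc e ℕ.+ x) * (2# ^ (k ℕ.* N) * h)))) ∎))

-- Transfer of polynomial relations

module _ {c ℓ} (A : ℤAlgebra c ℓ) (δ : ℤAlgebra.Carrier A) where
  private module A = ℤAlgebra A
  open A using (Carrier; _+_; _*_; -_; 0#; 1#; _≈_)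
  open A.Solver

  _≈_[mod-δ] : Carrier → Carrier → Set (c ⊔ ℓ)
  x ≈ y [mod-δ] = ∃[ z ] x ≈ y + δ * z

  ≈⇒mod : ∀ {x y} → x ≈ y → x ≈ y [mod-δ]
  ≈⇒mod {x} {y} x≈y = 0# , A.trans x≈y (solve 2 (λ y d → y := y :+ d :* con 0ℤ) A.refl y δ)

  -- The carrier is kept and only the equality coarsened, with the quotient by `δ` as witness.
  -- Congruences thus unfold to equations in the original ring, where powers of 2 can be cancelled.
  quotientRing : CommutativeRing c (c ⊔ ℓ)
  quotientRing = record
    { Carrier = Carrier
    ; _≈_ = _≈_[mod-δ]
    ; _+_ = _+_
    ; _*_ = _*_
    ; -_  = -_
    ; 0#  = 0#
    ; 1#  = 1#
    ; isCommutativeRing = record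
      { isRing = record
        { +-isAbelianGroup = record
          { isGroup = record
            { isMonoid = record
              { isSemigroup = record
                { isMagma = record
                  { isEquivalence = record
                    { refl  = ≈⇒mod A.refl
                    ; sym   = λ {x} {y} (z , x≈) → - z , A.trans
                        (solve 3 (λ y d z → y := (y :+ d :* z) :+ d :* (:- z)) A.refl y δ z) (A.+-congʳ (A.sym x≈))
                    ; trans = λ {x} {y} {w} (z , x≈) (v , y≈) → v + z , A.trans x≈ (A.trans (A.+-congʳ y≈)
                        (solve 4 (λ w d v z → (w :+ d :* v) :+ d :* z := w :+ d :* (v :+ z)) A.refl w δ v z))
                    }
                  ; ∙-cong = λ {x} {y} {u} {w} (z , x≈) (v , u≈) → z + v , A.trans (A.+-cong x≈ u≈)
                      (solve 5 (λ y w d z v → (y :+ d :* z) :+ (w :+ d :* v) := (y :+ w) :+ d :* (z :+ v)) A.refl y w δ z v)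
                  }
                ; assoc = λ x y z → ≈⇒mod (A.+-assoc x y z)
                }
              ; identity = (λ x → ≈⇒mod (A.+-identityˡ x)) , (λ x → ≈⇒mod (A.+-identityʳ x))
              }
            ; inverse = (λ x → ≈⇒mod (A.-‿inverseˡ x)) , (λ x → ≈⇒mod (A.-‿inverseʳ x))
            ; ⁻¹-cong = λ {x} {y} (z , x≈) → - z , A.trans (A.-‿cong x≈)
                (solve 3 (λ y d z → :- (y :+ d :* z) := :- y :+ d :* (:- z)) A.refl y δ z)
            }
          ; comm = λ x y → ≈⇒mod (A.+-comm x y)
          }
        ; *-cong = λ {x} {y} {u} {w} (z , x≈) (v , u≈) → y * v + z * w + δ * (z * v) , A.trans (A.*-cong x≈ u≈)
            (solve 5 (λ y w d z v → (y :+ d :* z) :* (w :+ d :* v) := y :* w :+ d :* (y :* v :+ z :* w :+ d :* (z :* v))) A.refl y w δ z v)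
        ; *-assoc = λ x y z → ≈⇒mod (A.*-assoc x y z)
        ; *-identity = (λ x → ≈⇒mod (A.*-identityˡ x)) , (λ x → ≈⇒mod (A.*-identityʳ x))
        ; distrib = (λ x y z → ≈⇒mod (A.distribˡ x y z)) , (λ x y z → ≈⇒mod (A.distribʳ x y z))
        }
      ; *-comm = λ x y → ≈⇒mod (A.*-comm x y)
      }
    }

  quotientAlgebra : ℤAlgebra c (c ⊔ ℓ)
  quotientAlgebra = record
    { commutativeRing = quotientRing
    ; κ = A.κ
    ; κ-isRingHomomorphism = record
      { isSemiringHomomorphism = record
        { isNearSemiringHomomorphism = record
          { +-isMonoidHomomorphism = record
            { isMagmaHomomorphism = record
              { isRelHomomorphism = record { cong = λ a≡b → ≈⇒mod (A.reflexive (cong A.κ a≡b)) }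
              ; homo = λ a b → ≈⇒mod (A.κ-+ a b)
              }
            ; ε-homo = ≈⇒mod A.κ-0
            }
          ; *-homo = λ a b → ≈⇒mod (A.κ-* a b)
          }
        ; 1#-homo = ≈⇒mod A.κ-1
        }
      ; -‿homo = λ a → ≈⇒mod (A.κ-neg a)
      }
    }

  quotient-^ : ∀ x n → ℤAlgebra._^_ quotientAlgebra x n ≡ x A.^ n
  quotient-^ x zero    = ≡.refl
  quotient-^ x (suc n) = cong (x *_) (quotient-^ x n)

module Homogenization {c ℓ} (A : ℤAlgebra c ℓ) where
  open ℤAlgebra A
  open Solver

  -- y^(length u) u(x/y)
  homogenize : List ℤ → Carrier → Carrier → Carrier
  homogenize []      x y = 0#
  homogenize (a ∷ u) x y = κ a * y ^ suc (List.length u) + x * homogenize u x y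

  homogenize-value : ∀ u {x y z} → y * z ≈ x → homogenize u x y ≈ y ^ List.length u * value u z
  homogenize-value []      eq = sym (zeroʳ _)
  homogenize-value (a ∷ u) {x} {y} {z} eq = trans (+-congˡ (*-cong (sym eq) (homogenize-value u eq)))
    (solve 5 (λ a y p z u → a :* (y :* p) :+ (y :* z) :* (p :* u) := (y :* p) :* (a :+ z :* u)) refl
      (κ a) y (y ^ List.length u) z (value u z))

  homogenize-cong : ∀ u {x x′ y y′} → x ≈ x′ → y ≈ y′ → homogenize u x y ≈ homogenize u x′ y′
  homogenize-cong []      x≈ y≈ = refl
  homogenize-cong (a ∷ u) x≈ y≈ = +-cong (*-congˡ (^-congˡ (suc (List.length u)) y≈)) (*-cong x≈ (homogenize-cong u x≈ y≈))

  homogenize-scale : ∀ u t x y → homogenize u (t * x) (t * y) ≈ t ^ List.length u * homogenize u x y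
  homogenize-scale []      t x y = sym (zeroʳ _)
  homogenize-scale (a ∷ u) t x y = trans (+-cong (*-congˡ (^-distrib-* t y (suc (List.length u)))) (*-congˡ (homogenize-scale u t x y)))
    (solve 6 (λ a t p q x h → a :* (t :* p :* q) :+ (t :* x) :* (p :* h) := (t :* p) :* (a :* q :+ x :* h)) refl
      (κ a) t (t ^ List.length u) (y ^ suc (List.length u)) x (homogenize u x y))

module _ {γ s} (E : EisensteinRing γ s) where
  open EisensteinRing E
  open Homogenization algebra

  -- Applied with `y` the odd part of the denominator: a `y` of residue 1 can be set to 1 in 𝔽₂.
  ψ-homogenize : ∀ u x y → ψ y ≡ 1ℙ → ψ (homogenize u x y) ≡ ℤAlgebra.value parityAlgebra u (ψ x)
  ψ-homogenize []      x y odd = ≡.trans (ψ-cong (sym κ-0)) (ψ-κ 0ℤ)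
  ψ-homogenize (a ∷ u) x y odd = ≡.trans (ψ-+ _ _) (cong₂ ℙ._+_
    (≡.trans (ψ-* (κ a) _) (≡.trans (cong₂ ℙ._*_ (ψ-κ a) (ψ-^ (suc (List.length u)) odd)) (ℙₚ.*-identityʳ _)))
    (≡.trans (ψ-* x _) (cong (ψ x ℙ.*_) (ψ-homogenize u x y odd))))

-- x in A and y in B that are values of one and the same integer polynomial at the generators.
module Simultaneous {c ℓ c′ ℓ′} (A : ℤAlgebra c ℓ) (B : ℤAlgebra c′ ℓ′) {n : ℕ} (0<n : 0 < n) (g : Vec ℤ n)
  (α : ℤAlgebra.Carrier A) (αⁿ≈ : ℤAlgebra._≈_ A (ℤAlgebra._^_ A α n) (ℤAlgebra.value A (toList g) α))
  (β : ℤAlgebra.Carrier B) (βⁿ≈ : ℤAlgebra._≈_ B (ℤAlgebra._^_ B β n) (ℤAlgebra.value B (toList g) β)) where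
  open Reduction g
  private
    module A = ℤAlgebra A
    module B = ℤAlgebra B
    module EA = Evaluation A α 0<n αⁿ≈
    module EB = Evaluation B β 0<n βⁿ≈

  record _∼_ (x : A.Carrier) (y : B.Carrier) : Set (ℓ ⊔ ℓ′) where
    constructor sim
    field
      v  : Vec ℤ n
      x≈ : x A.≈ A.value (toList v) α
      y≈ : y B.≈ B.value (toList v) β

  ∼-shift : ∀ {x y} → x ∼ y → (α A.* x) ∼ (β B.* y)
  ∼-shift (sim v x≈ y≈) = sim (shiftᵥ v)
    (A.trans (A.*-congˡ x≈) (A.sym (EA.ev-shift v))) (B.trans (B.*-congˡ y≈) (B.sym (EB.ev-shift v)))

  ∼-+ : ∀ {x y x′ y′} → x ∼ y → x′ ∼ y′ → (x A.+ x′) ∼ (y B.+ y′)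
  ∼-+ (sim v x≈ y≈) (sim w x′≈ y′≈) = sim (addᵥ v w)
    (A.trans (A.+-cong x≈ x′≈) (A.sym (ev-add A v w α))) (B.trans (B.+-cong y≈ y′≈) (B.sym (ev-add B v w β)))

  ∼-* : ∀ {x y x′ y′} → x ∼ y → x′ ∼ y′ → (x A.* x′) ∼ (y B.* y′)
  ∼-* (sim v x≈ y≈) (sim w x′≈ y′≈) = sim (mulᵥ v w)
    (A.trans (A.*-cong x≈ x′≈) (A.sym (EA.ev-mul v w))) (B.trans (B.*-cong y≈ y′≈) (B.sym (EB.ev-mul v w)))

  ∼-1 : A.1# ∼ B.1#
  ∼-1 = sim oneᵥ (A.sym (ev-one A α 0<n)) (B.sym (ev-one B β 0<n))

  ∼-κ : ∀ a → A.κ a ∼ B.κ a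
  ∼-κ a = sim (scaleᵥ a (oneᵥ {n}))
    (A.sym (ev-constant A a α 0<n)) (B.sym (ev-constant B a β 0<n))

  ∼-resp : ∀ {x y x′ y′} → x A.≈ x′ → y B.≈ y′ → x ∼ y → x′ ∼ y′
  ∼-resp x≈x′ y≈y′ (sim v x≈ y≈) = sim v (A.trans (A.sym x≈x′) x≈) (B.trans (B.sym y≈y′) y≈)

  ∼-generator : α ∼ β
  ∼-generator = ∼-resp (A.*-identityʳ α) (B.*-identityʳ β) (∼-shift ∼-1)

  ∼-0 : A.0# ∼ B.0#
  ∼-0 = ∼-resp A.κ-0 B.κ-0 (∼-κ 0ℤ)

  ∼-^ : ∀ {x y} n → x ∼ y → (x A.^ n) ∼ (y B.^ n)
  ∼-^ zero    x∼y = ∼-1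
  ∼-^ (suc n) x∼y = ∼-* x∼y (∼-^ n x∼y)

  ∼-value : ∀ u {x y} → x ∼ y → A.value u x ∼ B.value u y
  ∼-value []      x∼y = ∼-0
  ∼-value (a ∷ u) x∼y = ∼-+ (∼-κ a) (∼-* x∼y (∼-value u x∼y))

  module _ (independent : ∀ (v : Vec ℤ n) → A.value (toList v) α A.≈ A.0# → v ≡ Vec.replicate n 0ℤ) where

    -- This makes `α ↦ β` well defined on values: a coefficient vector that vanishes at `α` is zero
    -- by independence, so it vanishes at `β` too.
    transfer-0 : ∀ {x y} → x ∼ y → x A.≈ A.0# → y B.≈ B.0#
    transfer-0 (sim v x≈ y≈) x≈0 = B.trans y≈ (B.trans
      (B.reflexive (cong (λ v → B.value (toList v) β) (independent v (A.trans (A.sym x≈) x≈0)))) (ev-zero B n β))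

    transfer : ∀ {x y x′ y′} → x ∼ y → x′ ∼ y′ → x A.≈ x′ → y B.≈ y′
    transfer {x} {y} {x′} {y′} x∼y x′∼y′ x≈x′ = B.x∙y⁻¹≈ε⇒x≈y y y′ (B.trans (B.+-congˡ (negate y′)) (transfer-0
      (∼-+ x∼y (∼-* (∼-κ (ℤ.- 1ℤ)) x′∼y′))
      (A.trans (A.+-congʳ x≈x′) (solve 1 (λ x → x :+ con (ℤ.- 1ℤ) :* x := con 0ℤ) A.refl x′))))
      where
      open A.Solver
      negate : ∀ y → B.- y B.≈ B.κ (ℤ.- 1ℤ) B.* y
      negate = S.solve 1 (λ y → S.:- y S.:= S.con (ℤ.- 1ℤ) S.:* y) B.refl
        where module S = B.Solver

-- Eighth roots modulo powers of 2

sq : ℤ → ℤ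
sq x = x ℤ.* x

parity-2* : ∀ a → parityℤ (+ 2 ℤ.* a) ≡ 0ℙ
parity-2* a = parityℤ-homo-* (+ 2) a

odd-* : ∀ a b → parityℤ a ≡ 1ℙ → parityℤ b ≡ 1ℙ → parityℤ (a ℤ.* b) ≡ 1ℙ
odd-* a b a-odd b-odd = ≡.trans (parityℤ-homo-* a b) (cong₂ ℙ._*_ a-odd b-odd)

odd-+2* : ∀ a b → parityℤ a ≡ 1ℙ → parityℤ (a ℤ.+ + 2 ℤ.* b) ≡ 1ℙ
odd-+2* a b a-odd = ≡.trans (parityℤ-homo-+ a (+ 2 ℤ.* b)) (cong₂ ℙ._+_ a-odd (parity-2* b))

-- Each squaring doubles an odd perturbation, so replacing c by c + 4 T changes c⁸ by an odd
-- multiple of 32 T.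
square-perturbed : ∀ x m u → parityℤ x ≡ 1ℙ → parityℤ u ≡ 1ℙ →
  ∃[ u′ ] parityℤ u′ ≡ 1ℙ × sq (x ℤ.+ + 4 ℤ.* m ℤ.* u) ≡ sq x ℤ.+ + 4 ℤ.* (+ 2 ℤ.* m) ℤ.* u′
square-perturbed x m u x-odd u-odd = x ℤ.* u ℤ.+ + 2 ℤ.* (m ℤ.* (u ℤ.* u)) ,
  odd-+2* (x ℤ.* u) (m ℤ.* (u ℤ.* u)) (odd-* x u x-odd u-odd) ,
  solve 3 (λ x m u → (x :+ con (+ 4) :* m :* u) :* (x :+ con (+ 4) :* m :* u)
      := x :* x :+ con (+ 4) :* (con (+ 2) :* m) :* (x :* u :+ con (+ 2) :* (m :* (u :* u)))) ≡.refl x m u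
  where open ℤSolver

eighth-power-perturbed : ∀ c t → parityℤ c ≡ 1ℙ →
  ∃[ u ] parityℤ u ≡ 1ℙ × sq (sq (sq (c ℤ.+ + 4 ℤ.* t ℤ.* 1ℤ))) ≡ sq (sq (sq c)) ℤ.+ + 32 ℤ.* t ℤ.* u
eighth-power-perturbed c t c-odd = u₃ , proj₁ (proj₂ third) , (begin
    sq (sq (sq (c ℤ.+ + 4 ℤ.* t ℤ.* 1ℤ)))                             ≡⟨ cong (λ x → sq (sq x)) (proj₂ (proj₂ first)) ⟩
    sq (sq (sq c ℤ.+ + 4 ℤ.* (+ 2 ℤ.* t) ℤ.* u₁))                     ≡⟨ cong sq (proj₂ (proj₂ second)) ⟩
    sq (sq (sq c) ℤ.+ + 4 ℤ.* (+ 2 ℤ.* (+ 2 ℤ.* t)) ℤ.* u₂)           ≡⟨ proj₂ (proj₂ third) ⟩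
    sq (sq (sq c)) ℤ.+ + 4 ℤ.* (+ 2 ℤ.* (+ 2 ℤ.* (+ 2 ℤ.* t))) ℤ.* u₃
      ≡⟨ cong (λ m → sq (sq (sq c)) ℤ.+ m ℤ.* u₃) (thirty-two t) ⟩
    sq (sq (sq c)) ℤ.+ + 32 ℤ.* t ℤ.* u₃                              ∎)
  where
  open ≡-Reasoning
  thirty-two : ∀ t → + 4 ℤ.* (+ 2 ℤ.* (+ 2 ℤ.* (+ 2 ℤ.* t))) ≡ + 32 ℤ.* t
  thirty-two = solve 1 (λ t → con (+ 4) :* (con (+ 2) :* (con (+ 2) :* (con (+ 2) :* t))) := con (+ 32) :* t) ≡.refl
    where open ℤSolver
  Perturbed : ℤ → ℤ → ℤ → Set
  Perturbed x m u = ∃[ u′ ] parityℤ u′ ≡ 1ℙ × sq (x ℤ.+ + 4 ℤ.* m ℤ.* u) ≡ sq x ℤ.+ + 4 ℤ.* (+ 2 ℤ.* m) ℤ.* u′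
  first : Perturbed c t 1ℤ
  first = square-perturbed c t 1ℤ c-odd ≡.refl
  u₁ : ℤ
  u₁ = proj₁ first
  second : Perturbed (sq c) (+ 2 ℤ.* t) u₁
  second = square-perturbed (sq c) (+ 2 ℤ.* t) u₁ (odd-* c c c-odd c-odd) (proj₁ (proj₂ first))
  u₂ : ℤ
  u₂ = proj₁ second
  third : Perturbed (sq (sq c)) (+ 2 ℤ.* (+ 2 ℤ.* t)) u₂
  third = square-perturbed (sq (sq c)) (+ 2 ℤ.* (+ 2 ℤ.* t)) u₂
    (odd-* (sq c) (sq c) (odd-* c c c-odd c-odd) (odd-* c c c-odd c-odd)) (proj₁ (proj₂ second))
  u₃ : ℤ
  u₃ = proj₁ third

-- With the modulus written as `32 t`, the case `t = 1` is solved by `c = 1` for `b ≡ 1 (mod 32)`,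
-- and each lifting doubles `t`. The form `4 j + 1` keeps `c` in its class modulo 4.
EighthRoot : ℤ → ℤ → Set
EighthRoot b t = ∃[ j ] ∃[ z ] sq (sq (sq (+ 4 ℤ.* j ℤ.+ 1ℤ))) ≡ b ℤ.+ + 32 ℤ.* t ℤ.* z

-- Either c = 4 j + 1 or c + 4 T is a root modulo 64 T.
refine-eighth-root : ∀ b t → EighthRoot b t → EighthRoot b (+ 2 ℤ.* t)
refine-eighth-root b t (j , z , eq) = refine (parityℤ z) ≡.refl
  where
  open ≡-Reasoning
  c : ℤ
  c = + 4 ℤ.* j ℤ.+ 1ℤ
  c-odd : parityℤ c ≡ 1ℙ
  c-odd = ≡.trans (parityℤ-homo-+ (+ 4 ℤ.* j) 1ℤ) (cong (ℙ._+ 1ℙ) (parityℤ-homo-* (+ 4) j))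
  double : ∀ b t h → b ℤ.+ + 32 ℤ.* t ℤ.* (+ 2 ℤ.* h) ≡ b ℤ.+ + 32 ℤ.* (+ 2 ℤ.* t) ℤ.* h
  double = solve 3 (λ b t h → b :+ con (+ 32) :* t :* (con (+ 2) :* h) := b :+ con (+ 32) :* (con (+ 2) :* t) :* h) ≡.refl
    where open ℤSolver
  collect : ∀ b t z u → b ℤ.+ + 32 ℤ.* t ℤ.* z ℤ.+ + 32 ℤ.* t ℤ.* u ≡ b ℤ.+ + 32 ℤ.* t ℤ.* (z ℤ.+ u)
  collect = solve 4 (λ b t z u → b :+ con (+ 32) :* t :* z :+ con (+ 32) :* t :* u := b :+ con (+ 32) :* t :* (z :+ u)) ≡.refl
    where open ℤSolver
  shift : ∀ j t → + 4 ℤ.* (j ℤ.+ t) ℤ.+ 1ℤ ≡ + 4 ℤ.* j ℤ.+ 1ℤ ℤ.+ + 4 ℤ.* t ℤ.* 1ℤ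
  shift = solve 2 (λ j t → con (+ 4) :* (j :+ t) :+ con 1ℤ := con (+ 4) :* j :+ con 1ℤ :+ con (+ 4) :* t :* con 1ℤ) ≡.refl
    where open ℤSolver
  finish : ∀ j w → sq (sq (sq (+ 4 ℤ.* j ℤ.+ 1ℤ))) ≡ b ℤ.+ + 32 ℤ.* t ℤ.* w → parityℤ w ≡ 0ℙ → EighthRoot b (+ 2 ℤ.* t)
  finish j w eq w-even = j , proj₁ halved ,
    ≡.trans eq (≡.trans (cong (λ w → b ℤ.+ + 32 ℤ.* t ℤ.* w) (proj₂ halved)) (double b t (proj₁ halved)))
    where
    halved : ∃[ h ] w ≡ + 2 ℤ.* h
    halved = even⇒double w w-even
  refine : ∀ p → parityℤ z ≡ p → EighthRoot b (+ 2 ℤ.* t)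
  refine 0ℙ z-even = finish j z eq z-even
  refine 1ℙ z-odd  = finish (j ℤ.+ t) (z ℤ.+ u) (begin
    sq (sq (sq (+ 4 ℤ.* (j ℤ.+ t) ℤ.+ 1ℤ)))        ≡⟨ cong (λ x → sq (sq (sq x))) (shift j t) ⟩
    sq (sq (sq (c ℤ.+ + 4 ℤ.* t ℤ.* 1ℤ)))          ≡⟨ proj₂ (proj₂ perturbed) ⟩
    sq (sq (sq c)) ℤ.+ + 32 ℤ.* t ℤ.* u            ≡⟨ cong (λ x → x ℤ.+ + 32 ℤ.* t ℤ.* u) eq ⟩
    b ℤ.+ + 32 ℤ.* t ℤ.* z ℤ.+ + 32 ℤ.* t ℤ.* u    ≡⟨ collect b t z u ⟩
    b ℤ.+ + 32 ℤ.* t ℤ.* (z ℤ.+ u)                 ∎)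
    (≡.trans (parityℤ-homo-+ z u) (cong₂ ℙ._+_ z-odd (proj₁ (proj₂ perturbed))))
    where
    perturbed : ∃[ u ] parityℤ u ≡ 1ℙ × sq (sq (sq (c ℤ.+ + 4 ℤ.* t ℤ.* 1ℤ))) ≡ sq (sq (sq c)) ℤ.+ + 32 ℤ.* t ℤ.* u
    perturbed = eighth-power-perturbed c t c-odd
    u : ℤ
    u = proj₁ perturbed

eighth-root : ∀ b K → b ≡ 1ℤ ℤ.+ + 32 ℤ.* K → ∀ n → EighthRoot b ((+ 2) ℤ.^ n)
eighth-root b K b≡ zero    = 0ℤ , ℤ.- K , ≡.trans (base K) (cong (λ b → b ℤ.+ + 32 ℤ.* ℤ.- K) (≡.sym b≡))
  where
  base : ∀ k → 1ℤ ≡ (1ℤ ℤ.+ + 32 ℤ.* k) ℤ.+ + 32 ℤ.* (ℤ.- k)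
  base = solve 1 (λ k → con 1ℤ := (con 1ℤ :+ con (+ 32) :* k) :+ con (+ 32) :* (:- k)) ≡.refl
    where open ℤSolver
eighth-root b K b≡ (suc n) = refine-eighth-root b ((+ 2) ℤ.^ n) (eighth-root b K b≡ n)

-- The root γ = 4 j + 3 is going to be minus a power of the 8th root c ≡ 1 (mod 4).
ApproximateRoot : ℤ → ℕ → ℕ → Set
ApproximateRoot b a n = ∃[ j ] ∃[ z ] (+ 4 ℤ.* j ℤ.+ + 3) ℤ.^ (2 ℕ.^ a) ≡ b ℤ.+ (+ 2) ℤ.^ n ℤ.* z

sq-neg : ∀ x → sq (ℤ.- x) ≡ sq x
sq-neg = solve 1 (λ x → (:- x) :* (:- x) := x :* x) ≡.refl
  where open ℤSolver

^2 : ∀ x → x ℤ.^ (2 ℕ.^ 1) ≡ sq x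
^2 x = cong (x ℤ.*_) (ℤₚ.*-identityʳ x)

^-iterate : ∀ x a → x ℤ.^ (2 ℕ.^ suc a) ≡ sq x ℤ.^ (2 ℕ.^ a)
^-iterate x a = ≡.trans (≡.sym (ℤₚ.^-*-assoc x 2 (2 ℕ.^ a))) (cong (ℤ._^ (2 ℕ.^ a)) (^2 x))

negated-power : ∀ x a → (ℤ.- x) ℤ.^ (2 ℕ.^ suc a) ≡ x ℤ.^ (2 ℕ.^ suc a)
negated-power x a = ≡.trans (^-iterate (ℤ.- x) a) (≡.trans (cong (ℤ._^ (2 ℕ.^ a)) (sq-neg x)) (≡.sym (^-iterate x a)))

negate-mod-4 : ∀ j → + 4 ℤ.* (ℤ.- j ℤ.- 1ℤ) ℤ.+ + 3 ≡ ℤ.- (+ 4 ℤ.* j ℤ.+ 1ℤ)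
negate-mod-4 = solve 1 (λ j → con (+ 4) :* (:- j :- con 1ℤ) :+ con (+ 3) := :- (con (+ 4) :* j :+ con 1ℤ)) ≡.refl
  where open ℤSolver

sq-mod-4 : ∀ j → sq (+ 4 ℤ.* j ℤ.+ 1ℤ) ≡ + 4 ℤ.* (+ 4 ℤ.* (j ℤ.* j) ℤ.+ + 2 ℤ.* j) ℤ.+ 1ℤ
sq-mod-4 = solve 1 (λ j → (con (+ 4) :* j :+ con 1ℤ) :* (con (+ 4) :* j :+ con 1ℤ)
  := con (+ 4) :* (con (+ 4) :* (j :* j) :+ con (+ 2) :* j) :+ con 1ℤ) ≡.refl
  where open ℤSolver

PositiveRoot : ℤ → ℕ → ℕ → Set
PositiveRoot b a n = ∃[ j ] ∃[ z ] (+ 4 ℤ.* j ℤ.+ 1ℤ) ℤ.^ (2 ℕ.^ a) ≡ b ℤ.+ (+ 2) ℤ.^ n ℤ.* z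

sq-root : ∀ b n a → PositiveRoot b (suc a) n → PositiveRoot b a n
sq-root b n a (j , z , eq) = + 4 ℤ.* (j ℤ.* j) ℤ.+ + 2 ℤ.* j , z ,
  ≡.trans (cong (ℤ._^ (2 ℕ.^ a)) (≡.sym (sq-mod-4 j))) (≡.trans (≡.sym (^-iterate (+ 4 ℤ.* j ℤ.+ 1ℤ) a)) eq)

-- The exponent `2^(a + 1)` is even, so the sign is free, and it moves the root from the class of 1
-- to the class of 3 modulo 4 that `EisensteinRing` is built for.
negative-root : ∀ b n a → PositiveRoot b (suc a) n → ApproximateRoot b (suc a) n
negative-root b n a (j , z , eq) = ℤ.- j ℤ.- 1ℤ , z ,
  ≡.trans (cong (ℤ._^ (2 ℕ.^ suc a)) (negate-mod-4 j)) (≡.trans (negated-power (+ 4 ℤ.* j ℤ.+ 1ℤ) a) eq)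

positive-8th-root : ∀ b K → b ≡ 1ℤ ℤ.+ + 32 ℤ.* K → ∀ n → PositiveRoot b 3 n
positive-8th-root b K b≡ n with eighth-root b K b≡ n
... | j , z , eq = j , + 32 ℤ.* z , ≡.trans (pow8 (+ 4 ℤ.* j ℤ.+ 1ℤ)) (≡.trans eq (regroup b ((+ 2) ℤ.^ n) z))
  where
  pow8 : ∀ x → x ℤ.^ (2 ℕ.^ 3) ≡ sq (sq (sq x))
  pow8 x = ≡.trans (^-iterate x 2) (≡.trans (^-iterate (sq x) 1) (^2 (sq (sq x))))
  regroup : ∀ b t z → b ℤ.+ + 32 ℤ.* t ℤ.* z ≡ b ℤ.+ t ℤ.* (+ 32 ℤ.* z)
  regroup = solve 3 (λ b t z → b :+ con (+ 32) :* t :* z := b :+ t :* (con (+ 32) :* z)) ≡.refl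
    where open ℤSolver

-- Residues at a totally ramified prime

module Localization {c ℓ₁ ℓ₂} (L : FieldOverℚ c ℓ₁ ℓ₂) (b : ℤ) (r : ℕ)
  (irreducible : Irreducibleℚ (x^ (2 ℕ.^ r) -const b))
  (α : FieldOverℚ.Carrier L) (root : IsRoot L (x^ (2 ℕ.^ r) -const b) α)
  where

  n : ℕ
  n = 2 ℕ.^ r

  0<n : 0 < n
  0<n = ℕₚ.m^n>0 2 r

  private
    module A = ℤAlgebra (FieldExtension.asℤAlgebra L)
    module K = FieldExtension.SimpleExtension L b n 0<n irreducible α root
    module HA = Homogenization (FieldExtension.asℤAlgebra L)
  open A using () renaming (_≈_ to _≈ₗ_; _*_ to _*ₗ_; _^_ to _^ₗ_)

  module AtPrime {γ s} (E : EisensteinRing γ s) (a N : ℕ) (r≡ : r ≡ a ℕ.+ s)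
    (z : ℤ) (γ≈ : γ ℤ.^ (2 ℕ.^ a) ≡ b ℤ.+ (+ 2) ℤ.^ N ℤ.* z) where
    open EisensteinRing E
    open Homogenization algebra
    open Valuation E using (integrally-closed)
    open Solver

    private
      M : ℕ
      M = 2 ℕ.^ s

      B : ℤAlgebra 0ℓ 0ℓ
      B = quotientAlgebra algebra (2# ^ N)

      module B = ℤAlgebra B

      g : Vec ℤ n
      -- The constant polynomial `b`, so vectors are taken modulo `xⁿ - b`. The zero vector
      -- instantiates the module parameter while `g` itself is still being defined.
      g = Reduction.scaleᵥ (Vec.replicate n 0ℤ) b (Reduction.oneᵥ (Vec.replicate n 0ℤ))

    ρ-power : ∀ i → ρ ^ (2 ℕ.^ (i ℕ.+ s)) ≈ κ (γ ℤ.^ (2 ℕ.^ i))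
    ρ-power i = begin
      ρ ^ (2 ℕ.^ (i ℕ.+ s))          ≈⟨ ^-congʳ ρ (≡.trans (ℕₚ.^-distribˡ-+-* 2 i s) (ℕₚ.*-comm (2 ℕ.^ i) M)) ⟩
      ρ ^ (M ℕ.* 2 ℕ.^ i)            ≈⟨ ^-assocʳ ρ M (2 ℕ.^ i) ⟨
      (ρ ^ M) ^ (2 ℕ.^ i)            ≈⟨ ^-congˡ (2 ℕ.^ i) ρ^2ˢ ⟩
      κ γ ^ (2 ℕ.^ i)                ≈⟨ κ-^ γ (2 ℕ.^ i) ⟨
      κ (γ ℤ.^ (2 ℕ.^ i))            ∎
      where open ≈-Reasoning setoid

    private
      -- Here the approximate root enters: `ρⁿ = γ^(2^a)` agrees with `b` modulo `2ᴺ`.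
      ρⁿ≈ : ρ B.^ n B.≈ B.value (toList g) ρ
      ρⁿ≈ = B.trans (B.reflexive (quotient-^ algebra (2# ^ N) ρ n))
        (B.trans (κ z , (begin
          ρ ^ n                              ≈⟨ ^-congʳ ρ (cong (2 ℕ.^_) r≡) ⟩
          ρ ^ (2 ℕ.^ (a ℕ.+ s))              ≈⟨ ρ-power a ⟩
          κ (γ ℤ.^ (2 ℕ.^ a))                ≈⟨ reflexive (cong κ γ≈) ⟩
          κ (b ℤ.+ (+ 2) ℤ.^ N ℤ.* z)        ≈⟨ trans (κ-+ b _) (+-congˡ (trans (κ-* _ z) (*-congʳ (κ-^ (+ 2) N)))) ⟩
          κ b + 2# ^ N * κ z                 ∎))
        (B.sym (Reduction.ev-constant g B b ρ 0<n)))
        where open ≈-Reasoning setoid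

      αⁿ≈ : (α ^ₗ n) ≈ₗ A.value (toList g) α
      αⁿ≈ = A.trans K.αⁿ≈b (A.sym (Reduction.ev-constant g (FieldExtension.asℤAlgebra L) b α 0<n))

    open Simultaneous (FieldExtension.asℤAlgebra L) B 0<n g α αⁿ≈ ρ ρⁿ≈ public
      using (_∼_; ∼-+; ∼-*; ∼-κ; ∼-1; ∼-generator)
    private module S = Simultaneous (FieldExtension.asℤAlgebra L) B 0<n g α αⁿ≈ ρ ρⁿ≈

    ∼-^ : ∀ {x y} m → x ∼ y → (x ^ₗ m) ∼ (y ^ m)
    ∼-^ {x} {y} m x∼y = ≡.subst (λ w → (x ^ₗ m) ∼ w) (quotient-^ algebra (2# ^ N) y m) (S.∼-^ m x∼y)

    ∼-homogenize : ∀ u {x y x′ y′} → x ∼ y → x′ ∼ y′ → HA.homogenize u x x′ ∼ homogenize u y y′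
    ∼-homogenize []      x∼ y∼ = S.∼-0
    ∼-homogenize (a ∷ u) x∼ y∼ = ∼-+ (∼-* (∼-κ a) (∼-^ (suc (List.length u)) y∼)) (∼-* x∼ (∼-homogenize u x∼ y∼))

    transfer : ∀ {x y x′ y′} → x ∼ y → x′ ∼ y′ → x ≈ₗ x′ → ∃[ w ] y ≈ y′ + 2# ^ N * w
    transfer = S.transfer K.linearly-independent

    module _ (η : A.Carrier) (k : ℕ) (σ : ℤ) (σ-odd : parityℤ σ ≡ 1ℙ) (q : List ℤ)
             (dη≈q : (A.κ ((+ 2) ℤ.^ k ℤ.* σ) *ₗ η) ≈ₗ A.value q α) where

      private
        d : ℤ
        d = (+ 2) ℤ.^ k ℤ.* σ

        κd≈ : κ d ≈ 2# ^ k * κ σ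
        κd≈ = trans (κ-* _ σ) (*-congʳ (κ-^ (+ 2) k))

        κd^ : ∀ m → κ d ^ m ≈ 2# ^ (k ℕ.* m) * κ σ ^ m
        κd^ m = trans (^-congˡ m κd≈) (trans (^-distrib-* (2# ^ k) (κ σ) m) (*-congʳ (^-assocʳ 2# k m)))

        q∼ : A.value q α ∼ value q ρ
        q∼ = S.∼-value q ∼-generator

      -- Every power of `η` is a polynomial of length `D` in `η`, so multiplying by `d^D` clears its
      -- denominators whatever the exponent. Hence `d^D q(α)^I` is `d^I` times an integer polynomial
      -- in `q(α)` and `d`. After transfer to `ρ` the error is a multiple of `2ᴺ` with `N ≥ k I`, so
      -- `2^(k I)` still divides the right side and `integrally-closed` applies.
      integral⇒divisible : ∀ D → (∀ i → ∃[ u ] List.length u ≡ D × (η ^ₗ i) ≈ₗ A.value u η) →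
        ∀ N′ → N ≡ k ℕ.* (M ℕ.* suc (k ℕ.* D)) ℕ.+ N′ → ∃[ q′ ] value q ρ ≈ 2# ^ k * q′
      integral⇒divisible D powers N′ N≡ = integrally-closed (k ℕ.* D) (κ σ ^ D) (ψ-^ D (≡.trans (ψ-κ σ) σ-odd)) k (value q ρ)
        (κ σ ^ I * homogenize u (value q ρ) (κ d) + 2# ^ N′ * w) (begin
          2# ^ (k ℕ.* D) * κ σ ^ D * value q ρ ^ I           ≈⟨ *-congʳ (κd^ D) ⟨
          κ d ^ D * value q ρ ^ I                            ≈⟨ proj₂ relation ⟩
          κ d ^ I * homogenize u (value q ρ) (κ d) + 2# ^ N * w
            ≈⟨ +-cong (*-congʳ (κd^ I)) (*-congʳ (trans (^-congʳ 2# N≡) (^-homo-* 2# (k ℕ.* I) N′))) ⟩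
          2# ^ (k ℕ.* I) * κ σ ^ I * homogenize u (value q ρ) (κ d) + 2# ^ (k ℕ.* I) * 2# ^ N′ * w
            ≈⟨ solve 5 (λ f s h t w → f :* s :* h :+ f :* t :* w := f :* (s :* h :+ t :* w)) refl
                 (2# ^ (k ℕ.* I)) (κ σ ^ I) (homogenize u (value q ρ) (κ d)) (2# ^ N′) w ⟩
          2# ^ (k ℕ.* I) * (κ σ ^ I * homogenize u (value q ρ) (κ d) + 2# ^ N′ * w) ∎)
        where
        -- The exponent demanded by `integrally-closed` for the bound `e = k D`, which is the power
        -- of 2 in `d^D`.
        I : ℕ
        I = M ℕ.* suc (k ℕ.* D)
        u : List ℤ
        u = proj₁ (powers I)
        relationₗ : ((A.κ d ^ₗ D) *ₗ (A.value q α ^ₗ I)) ≈ₗ ((A.κ d ^ₗ I) *ₗ HA.homogenize u (A.value q α) (A.κ d))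
        relationₗ = begin
          (A.κ d ^ₗ D) *ₗ (A.value q α ^ₗ I)                  ≈⟨ A.*-congˡ (A.trans (A.^-congˡ I (A.sym dη≈q)) (A.^-distrib-* (A.κ d) η I)) ⟩
          (A.κ d ^ₗ D) *ₗ ((A.κ d ^ₗ I) *ₗ (η ^ₗ I))          ≈⟨ A.*-congˡ (A.*-congˡ (proj₂ (proj₂ (powers I)))) ⟩
          (A.κ d ^ₗ D) *ₗ ((A.κ d ^ₗ I) *ₗ A.value u η)       ≈⟨ LS.solve 3 (λ x y z → x LS.:* (y LS.:* z) LS.:= y LS.:* (x LS.:* z)) A.refl _ _ _ ⟩
          (A.κ d ^ₗ I) *ₗ ((A.κ d ^ₗ D) *ₗ A.value u η)       ≈⟨ A.*-congˡ (A.*-congʳ (A.^-congʳ (A.κ d) (proj₁ (proj₂ (powers I))))) ⟨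
          (A.κ d ^ₗ I) *ₗ ((A.κ d ^ₗ List.length u) *ₗ A.value u η) ≈⟨ A.*-congˡ (HA.homogenize-value u dη≈q) ⟨
          (A.κ d ^ₗ I) *ₗ HA.homogenize u (A.value q α) (A.κ d) ∎
          where
          open ≈-Reasoning A.setoid
          module LS = A.Solver
        relation : ∃[ w ] κ d ^ D * value q ρ ^ I ≈ κ d ^ I * homogenize u (value q ρ) (κ d) + 2# ^ N * w
        relation = transfer (∼-* (∼-^ D (∼-κ d)) (∼-^ I q∼)) (∼-* (∼-^ I (∼-κ d)) (∼-homogenize u q∼ (∼-κ d))) relationₗ
        w : Carrier
        w = proj₁ relation
        open ≈-Reasoning setoid

      -- Clearing denominators in `x = u(η)` gives `d^l p = 2^e` times the homogenized `u` at
      -- `(q(α), d)`. At `ρ` both arguments are divisible by `2ᵏ`, so `2^(k l + e)` cancels and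
      -- leaves `u` homogenized at `(q′, σ)`, whose residue is `u(ψ q′)`.
      residue : ∀ q′ → value q ρ ≈ 2# ^ k * q′ →
        ∀ {x p} u e P m N′ → x ≈ₗ A.value u η → ((A.2# ^ₗ e) *ₗ x) ≈ₗ p → p ∼ P → P ≈ 2# ^ e * κ m →
        N ≡ k ℕ.* List.length u ℕ.+ (e ℕ.+ suc N′) → parityℤ m ≡ ℤAlgebra.value parityAlgebra u (ψ q′)
      residue q′ q≈ {x} {p} u e P m N′ x≈u 2x≈p p∼P P≈m N≡ = begin
        parityℤ m                                               ≡⟨ ψ-κ m ⟨
        ψ (κ m)                                                 ≡⟨ cong (ℙ._* ψ (κ m)) (ψ-^ l (≡.trans (ψ-κ σ) σ-odd)) ⟨
        ψ (κ σ ^ l) ℙ.* ψ (κ m)                                 ≡⟨ ψ-* (κ σ ^ l) (κ m) ⟨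
        ψ (κ σ ^ l * κ m)                                       ≡⟨ ψ-cong reduced ⟩
        ψ (homogenize u q′ (κ σ) + 2# * (2# ^ N′ * w))          ≡⟨ ≡.trans (ψ-+ _ _) (cong (ψ (homogenize u q′ (κ σ)) ℙ.+_) (ψ-2* _)) ⟩
        ψ (homogenize u q′ (κ σ)) ℙ.+ 0ℙ                        ≡⟨ ℙₚ.+-identityʳ _ ⟩
        ψ (homogenize u q′ (κ σ))                               ≡⟨ ψ-homogenize E u q′ (κ σ) (≡.trans (ψ-κ σ) σ-odd) ⟩
        ℤAlgebra.value parityAlgebra u (ψ q′)                   ∎
        where
        open ≡-Reasoning
        l : ℕ
        l = List.length u
        relationₗ : ((A.κ d ^ₗ l) *ₗ p) ≈ₗ ((A.κ (+ 2) ^ₗ e) *ₗ HA.homogenize u (A.value q α) (A.κ d))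
        relationₗ = A.trans (A.*-congˡ (A.trans (A.sym 2x≈p) (A.*-congˡ x≈u)))
          (A.trans (LS.solve 3 (λ x y z → x LS.:* (y LS.:* z) LS.:= y LS.:* (x LS.:* z)) A.refl _ _ _)
          (A.*-congˡ (A.sym (HA.homogenize-value u dη≈q))))
          where module LS = A.Solver
        relation : ∃[ w ] κ d ^ l * P ≈ 2# ^ e * homogenize u (value q ρ) (κ d) + 2# ^ N * w
        relation = transfer (∼-* (∼-^ l (∼-κ d)) p∼P) (∼-* (∼-^ e (∼-κ (+ 2))) (∼-homogenize u q∼ (∼-κ d))) relationₗ
        w : Carrier
        w = proj₁ relation
        -- The precision `N` exceeds the cancelled exponent by `suc N′`, so the surviving error
        -- keeps a factor 2 and is invisible to `ψ`.
        reduced : κ σ ^ l * κ m ≈ homogenize u q′ (κ σ) + 2# * (2# ^ N′ * w)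
        reduced = 2^-cancel e (2^-cancel (k ℕ.* l) (R.begin
          F * (2# ^ e * (κ σ ^ l * κ m))                        R.≈⟨ solve 4 (λ f e s m → f :* (e :* (s :* m)) := f :* s :* (e :* m)) refl F (2# ^ e) (κ σ ^ l) (κ m) ⟩
          F * κ σ ^ l * (2# ^ e * κ m)                          R.≈⟨ *-cong (κd^ l) P≈m ⟨
          κ d ^ l * P                                           R.≈⟨ proj₂ relation ⟩
          2# ^ e * homogenize u (value q ρ) (κ d) + 2# ^ N * w
            R.≈⟨ +-cong (*-congˡ (trans (homogenize-cong u q≈ κd≈) (trans (homogenize-scale u (2# ^ k) q′ (κ σ)) (*-congʳ (^-assocʳ 2# k l)))))
                        (*-congʳ (trans (^-congʳ 2# N≡) (trans (^-homo-* 2# (k ℕ.* l) _) (*-congˡ (^-homo-* 2# e (suc N′)))))) ⟩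
          2# ^ e * (F * homogenize u q′ (κ σ)) + F * (2# ^ e * (2# * 2# ^ N′)) * w
            R.≈⟨ solve 6 (λ f e h t n w → e :* (f :* h) :+ f :* (e :* (t :* n)) :* w := f :* (e :* (h :+ t :* (n :* w)))) refl
                   F (2# ^ e) (homogenize u q′ (κ σ)) 2# (2# ^ N′) w ⟩
          F * (2# ^ e * (homogenize u q′ (κ σ) + 2# * (2# ^ N′ * w))) R.∎))
          where
          module R = ≈-Reasoning setoid
          F : Carrier
          F = 2# ^ (k ℕ.* l)

-- γ^(2^(i+1)) = 8 w + 1 for γ ≡ 3 (mod 4).
eighth : ℕ → ℤ → ℤ
eighth zero    j = + 2 ℤ.* (j ℤ.* j) ℤ.+ + 3 ℤ.* j ℤ.+ 1ℤ
eighth (suc i) j = + 8 ℤ.* sq (eighth i j) ℤ.+ + 2 ℤ.* eighth i j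

eighth-spec : ∀ i j → (+ 4 ℤ.* j ℤ.+ + 3) ℤ.^ (2 ℕ.^ suc i) ≡ + 8 ℤ.* eighth i j ℤ.+ 1ℤ
eighth-spec zero    j = ≡.trans (^2 (+ 4 ℤ.* j ℤ.+ + 3)) (square j)
  where
  square : ∀ j → sq (+ 4 ℤ.* j ℤ.+ + 3) ≡ + 8 ℤ.* (+ 2 ℤ.* (j ℤ.* j) ℤ.+ + 3 ℤ.* j ℤ.+ 1ℤ) ℤ.+ 1ℤ
  square = solve 1 (λ j → (con (+ 4) :* j :+ con (+ 3)) :* (con (+ 4) :* j :+ con (+ 3))
    := con (+ 8) :* (con (+ 2) :* (j :* j) :+ con (+ 3) :* j :+ con 1ℤ) :+ con 1ℤ) ≡.refl
    where open ℤSolver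
eighth-spec (suc i) j = begin
  γ ℤ.^ (2 ℕ.^ suc (suc i))          ≡⟨ cong (γ ℤ.^_) (ℕₚ.*-comm 2 (2 ℕ.^ suc i)) ⟩
  γ ℤ.^ (2 ℕ.^ suc i ℕ.* 2)          ≡⟨ ℤₚ.^-*-assoc γ (2 ℕ.^ suc i) 2 ⟨
  (γ ℤ.^ (2 ℕ.^ suc i)) ℤ.^ 2        ≡⟨ ^2 (γ ℤ.^ (2 ℕ.^ suc i)) ⟩
  sq (γ ℤ.^ (2 ℕ.^ suc i))           ≡⟨ cong sq (eighth-spec i j) ⟩
  sq (+ 8 ℤ.* eighth i j ℤ.+ 1ℤ)     ≡⟨ square (eighth i j) ⟩
  + 8 ℤ.* eighth (suc i) j ℤ.+ 1ℤ    ∎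
  where
  open ≡-Reasoning
  γ : ℤ
  γ = + 4 ℤ.* j ℤ.+ + 3
  square : ∀ w → sq (+ 8 ℤ.* w ℤ.+ 1ℤ) ≡ + 8 ℤ.* (+ 8 ℤ.* sq w ℤ.+ + 2 ℤ.* w) ℤ.+ 1ℤ
  square = solve 1 (λ w → (con (+ 8) :* w :+ con 1ℤ) :* (con (+ 8) :* w :+ con 1ℤ)
    := con (+ 8) :* (con (+ 8) :* (w :* w) :+ con (+ 2) :* w) :+ con 1ℤ) ≡.refl
    where open ℤSolver

-- This is `(γ^(2ⁱ) + 1)/2` for `γ = 4 j + 3`. As 4 divides `γ + 1` while `γ^(2ⁱ) ≡ 1 (mod 8)` for
-- `i > 0`, it is even at `i = 0` and odd afterwards; this switch tells the three primes apart.
half : ℕ → ℤ → ℤ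
half zero    j = + 2 ℤ.* (j ℤ.+ 1ℤ)
half (suc i) j = 1ℤ ℤ.+ + 2 ℤ.* (+ 2 ℤ.* eighth i j)

half-spec : ∀ i j → (+ 4 ℤ.* j ℤ.+ + 3) ℤ.^ (2 ℕ.^ i) ℤ.+ 1ℤ ≡ + 2 ℤ.* half i j
half-spec zero    j = solve 1 (λ j → (con (+ 4) :* j :+ con (+ 3)) :* con 1ℤ :+ con 1ℤ := con (+ 2) :* (con (+ 2) :* (j :+ con 1ℤ))) ≡.refl j
  where open ℤSolver
half-spec (suc i) j = ≡.trans (cong (ℤ._+ 1ℤ) (eighth-spec i j)) (halve-it (eighth i j))
  where
  halve-it : ∀ w → + 8 ℤ.* w ℤ.+ 1ℤ ℤ.+ 1ℤ ≡ + 2 ℤ.* (1ℤ ℤ.+ + 2 ℤ.* (+ 2 ℤ.* w))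
  halve-it = solve 1 (λ w → con (+ 8) :* w :+ con 1ℤ :+ con 1ℤ := con (+ 2) :* (con 1ℤ :+ con (+ 2) :* (con (+ 2) :* w))) ≡.refl
    where open ℤSolver

half-zero-even : ∀ j → parityℤ (half 0 j) ≡ 0ℙ
half-zero-even j = parity-2* (j ℤ.+ 1ℤ)

half-suc-odd : ∀ i j → parityℤ (half (suc i) j) ≡ 1ℙ
half-suc-odd i j = odd-+2* 1ℤ (+ 2 ℤ.* eighth i j) ≡.refl

-- Integral elements of ℚ(α)

module IntegralElements {c ℓ₁ ℓ₂} (L : FieldOverℚ c ℓ₁ ℓ₂) where
  open FieldOverℚ L using (ι; ι-isRingHomomorphism)
  private module ι = IsRingHomomorphism ι-isRingHomomorphism
  open FieldExtension L
  open ℤAlgebra asℤAlgebra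
  open Solver

  ½ : Carrier
  ½ = ι ℚ.½

  2*½ : 2# * ½ ≈ 1#
  2*½ = trans (sym (ι.*-homo (fromℤ (+ 2)) ℚ.½)) ι.1#-homo

  2*½* : ∀ x → 2# * (½ * x) ≈ x
  2*½* x = trans (sym (*-assoc 2# ½ x)) (trans (*-congʳ 2*½) (*-identityˡ x))

  2-cancelₗ : ∀ {x y} → 2# * x ≈ 2# * y → x ≈ y
  2-cancelₗ {x} {y} eq = trans (sym (2*½* x)) (trans (swap x) (trans (*-congˡ eq) (trans (sym (swap y)) (2*½* y))))
    where
    swap : ∀ x → 2# * (½ * x) ≈ ½ * (2# * x)
    swap = solve 2 (λ h x → con (+ 2) :* (h :* x) := h :* (con (+ 2) :* x)) refl ½

  value-monic : ∀ p x → value (p ∷ʳ 1ℤ) x ≈ value p x + x ^ List.length p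
  value-monic []      x = trans (+-cong κ-1 (zeroʳ x)) (+-comm 1# 0#)
  value-monic (a ∷ p) x = trans (+-congˡ (*-congˡ (value-monic p x)))
    (solve 4 (λ a x p q → a :+ x :* (p :+ q) := (a :+ x :* p) :+ x :* q) refl (κ a) x (value p x) (x ^ List.length p))

  value-neg : ∀ p x → value (map ℤ.-_ p) x ≈ - value p x
  value-neg []      x = solve 0 (con 0ℤ := :- con 0ℤ) refl
  value-neg (a ∷ p) x = trans (+-cong (κ-neg a) (*-congˡ (value-neg p x)))
    (solve 3 (λ a x p → :- a :+ x :* (:- p) := :- (a :+ x :* p)) refl (κ a) x (value p x))

  integral-powers : ∀ {η} → IsIntegral L η → ∃[ D ] ∀ i → ∃[ u ] List.length u ≡ D × η ^ i ≈ value u η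
  integral-powers {η} (p , pη≈0) = List.length g , λ i →
    toList (Reduction.powᵥ gᵥ i) , Vecₚ.length-toList (Reduction.powᵥ gᵥ i) ,
    sym (Reduction.Evaluation.ev-pow gᵥ asℤAlgebra η (s≤s z≤n) reduce i)
    where
    -- The integral equation is multiplied by `x`, so that the reduction has positive length even
    -- for an empty `p`.
    g : List ℤ
    g = 0ℤ ∷ map ℤ.-_ p
    gᵥ : Vec ℤ (List.length g)
    gᵥ = Vec.fromList g
    open ≈-Reasoning setoid
    top : η ^ List.length p ≈ - value p η
    top = begin
      η ^ List.length p                                ≈⟨ solve 2 (λ p t → t := (p :+ t) :- p) refl (value p η) (η ^ List.length p) ⟩
      (value p η + η ^ List.length p) - value p η      ≈⟨ +-congʳ (trans (sym (value-monic p η)) (trans (sym (evalℤ≈ (p ∷ʳ 1ℤ) η)) pη≈0)) ⟩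
      0# - value p η                                   ≈⟨ +-identityˡ _ ⟩
      - value p η                                      ∎
    reduce : η ^ List.length g ≈ value (toList gᵥ) η
    reduce = begin
      η * η ^ List.length (map ℤ.-_ p)                 ≈⟨ *-congˡ (^-congʳ η (Listₚ.length-map ℤ.-_ p)) ⟩
      η * η ^ List.length p                            ≈⟨ *-congˡ (trans top (sym (value-neg p η))) ⟩
      η * value (map ℤ.-_ p) η                         ≈⟨ trans (+-congʳ κ-0) (+-identityˡ _) ⟨
      value g η                                        ≈⟨ reflexive (cong (λ l → value l η) (Vecₚ.toList∘fromList g)) ⟨
      value (toList gᵥ) η                              ∎

  module _ {α : Carrier} where
    1∈ : ℚ⟨_⟩ L α 1#
    1∈ = resp ι.1#-homo (scalar 1ℚ)

    ^∈ : ∀ n → ℚ⟨_⟩ L α (α ^ n)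
    ^∈ zero    = 1∈
    ^∈ (suc n) = mul gen (^∈ n)

  -- e is a root of x² - x - 8 K, and v is a root of x² - e x - 4 K e; the quartic equation of v is
  -- the norm of the latter.
  module _ (K : ℤ) (y : Carrier) (y⁴ : (y * y) * (y * y) ≈ 1# + κ (+ 32) * κ K) where

    e v : Carrier
    e = ½ * (y * y + 1#)
    v = ½ * ((y + 1#) * e)

    e² : e * e ≈ e + κ (+ 8) * κ K
    e² = 2-cancelₗ (2-cancelₗ (begin
      2# * (2# * (e * e))                                    ≈⟨ solve 1 (λ e → con (+ 2) :* (con (+ 2) :* (e :* e)) := (con (+ 2) :* e) :* (con (+ 2) :* e)) refl e ⟩
      (2# * e) * (2# * e)                                    ≈⟨ *-cong (2*½* _) (2*½* _) ⟩
      (y * y + 1#) * (y * y + 1#)                            ≈⟨ solve 1 (λ y → (y :* y :+ con 1ℤ) :* (y :* y :+ con 1ℤ) := (y :* y) :* (y :* y) :+ (con (+ 2) :* (y :* y :+ con 1ℤ) :- con 1ℤ)) refl y ⟩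
      (y * y) * (y * y) + (2# * (y * y + 1#) - 1#)           ≈⟨ +-cong y⁴ (+-congʳ (*-congˡ (sym (2*½* _)))) ⟩
      (1# + κ (+ 32) * κ K) + (2# * (2# * e) - 1#)           ≈⟨ solve 2 (λ e k → (con 1ℤ :+ con (+ 32) :* k) :+ (con (+ 2) :* (con (+ 2) :* e) :- con 1ℤ) := con (+ 2) :* (con (+ 2) :* (e :+ con (+ 8) :* k))) refl e (κ K) ⟩
      2# * (2# * (e + κ (+ 8) * κ K))                        ∎))
      where open ≈-Reasoning setoid

    v² : v * v ≈ e * (v + κ (+ 4) * κ K)
    v² = 2-cancelₗ (2-cancelₗ (begin
      2# * (2# * (v * v))                                    ≈⟨ solve 1 (λ e → con (+ 2) :* (con (+ 2) :* (e :* e)) := (con (+ 2) :* e) :* (con (+ 2) :* e)) refl v ⟩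
      (2# * v) * (2# * v)                                    ≈⟨ *-cong (2*½* _) (2*½* _) ⟩
      ((y + 1#) * e) * ((y + 1#) * e)                        ≈⟨ solve 2 (λ y e → ((y :+ con 1ℤ) :* e) :* ((y :+ con 1ℤ) :* e) := (y :* y :+ con 1ℤ) :* (e :* e) :+ con (+ 2) :* y :* (e :* e)) refl y e ⟩
      (y * y + 1#) * (e * e) + 2# * y * (e * e)              ≈⟨ +-congʳ (*-congʳ (sym (2*½* _))) ⟩
      2# * e * (e * e) + 2# * y * (e * e)                    ≈⟨ +-congʳ (*-congˡ e²) ⟩
      2# * e * (e + κ (+ 8) * κ K) + 2# * y * (e * e)        ≈⟨ solve 3 (λ y e k → con (+ 2) :* e :* (e :+ con (+ 8) :* k) :+ con (+ 2) :* y :* (e :* e) := con (+ 2) :* (e :* ((y :+ con 1ℤ) :* e :+ con (+ 8) :* k))) refl y e (κ K) ⟩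
      2# * (e * ((y + 1#) * e + κ (+ 8) * κ K))              ≈⟨ *-congˡ (*-congˡ (+-congʳ (sym (2*½* _)))) ⟩
      2# * (e * (2# * v + κ (+ 8) * κ K))                    ≈⟨ solve 3 (λ e v k → con (+ 2) :* (e :* (con (+ 2) :* v :+ con (+ 8) :* k)) := con (+ 2) :* (con (+ 2) :* (e :* (v :+ con (+ 4) :* k)))) refl e v (κ K) ⟩
      2# * (2# * (e * (v + κ (+ 4) * κ K)))                  ∎))
      where open ≈-Reasoning setoid

    e-integral : IsIntegral L e
    e-integral = ℤ.- (+ 8 ℤ.* K) ∷ ℤ.- 1ℤ ∷ [] , (begin
      evalℤ L (ℤ.- (+ 8 ℤ.* K) ∷ ℤ.- 1ℤ ∷ 1ℤ ∷ []) e         ≈⟨ evalℤ≈ (ℤ.- (+ 8 ℤ.* K) ∷ ℤ.- 1ℤ ∷ 1ℤ ∷ []) e ⟩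
      κ (ℤ.- (+ 8 ℤ.* K)) + e * (κ (ℤ.- 1ℤ) + e * (κ 1ℤ + e * 0#))
        ≈⟨ +-cong (trans (κ-neg (+ 8 ℤ.* K)) (-‿cong (κ-* (+ 8) K))) (*-congˡ (+-congˡ (*-congˡ (+-congʳ κ-1)))) ⟩
      - (κ (+ 8) * κ K) + e * (κ (ℤ.- 1ℤ) + e * (1# + e * 0#))
        ≈⟨ solve 2 (λ e k → :- (con (+ 8) :* k) :+ e :* (con (ℤ.- 1ℤ) :+ e :* (con 1ℤ :+ e :* con 0ℤ)) := e :* e :- (e :+ con (+ 8) :* k)) refl e (κ K) ⟩
      e * e - (e + κ (+ 8) * κ K)                            ≈⟨ x≈y⇒x∙y⁻¹≈ε e² ⟩
      0#                                                     ∎)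
      where open ≈-Reasoning setoid

    -- Put `w = v + 4 K`, so `v² = e w`. Squaring, replacing `e²` by `e + 8 K` and then `e w` by
    -- `v²` eliminates `e`: `v⁴ = v² w + 8 K w²`. Expanding gives the coefficients.
    v-integral : IsIntegral L v
    v-integral = c₀ ∷ c₁ ∷ c₂ ∷ ℤ.- 1ℤ ∷ [] , (begin
      evalℤ L (c₀ ∷ c₁ ∷ c₂ ∷ ℤ.- 1ℤ ∷ 1ℤ ∷ []) v              ≈⟨ evalℤ≈ (c₀ ∷ c₁ ∷ c₂ ∷ ℤ.- 1ℤ ∷ 1ℤ ∷ []) v ⟩
      κ c₀ + v * (κ c₁ + v * (κ c₂ + v * (κ (ℤ.- 1ℤ) + v * (κ 1ℤ + v * 0#))))
        ≈⟨ +-cong (trans (κ-* (ℤ.- + 128) (K ℤ.* (K ℤ.* K))) (*-congˡ (trans (κ-* K (K ℤ.* K)) (*-congˡ (κ-* K K)))))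
           (*-congˡ (+-cong (trans (κ-* (ℤ.- + 64) (K ℤ.* K)) (*-congˡ (κ-* K K)))
           (*-congˡ (+-cong (κ-* (ℤ.- + 12) K) (*-congˡ (+-congˡ (*-congˡ (+-congʳ κ-1)))))))) ⟩
      κ (ℤ.- + 128) * (k * (k * k)) + v * (κ (ℤ.- + 64) * (k * k) + v * (κ (ℤ.- + 12) * k + v * (κ (ℤ.- 1ℤ) + v * (1# + v * 0#))))
        ≈⟨ solve 2 (λ v k → con (ℤ.- + 128) :* (k :* (k :* k)) :+ v :* (con (ℤ.- + 64) :* (k :* k) :+ v :* (con (ℤ.- + 12) :* k :+ v :* (con (ℤ.- 1ℤ) :+ v :* (con 1ℤ :+ v :* con 0ℤ))))
              := (v :* v) :* (v :* v) :- ((v :* v) :* (v :+ con (+ 4) :* k) :+ con (+ 8) :* k :* ((v :+ con (+ 4) :* k) :* (v :+ con (+ 4) :* k)))) refl v k ⟩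
      (v * v) * (v * v) - ((v * v) * w + κ (+ 8) * k * (w * w)) ≈⟨ x≈y⇒x∙y⁻¹≈ε v⁴ ⟩
      0#                                                       ∎)
      where
      open ≈-Reasoning setoid
      c₀ c₁ c₂ : ℤ
      c₀ = ℤ.- + 128 ℤ.* (K ℤ.* (K ℤ.* K))
      c₁ = ℤ.- + 64 ℤ.* (K ℤ.* K)
      c₂ = ℤ.- + 12 ℤ.* K
      k w : Carrier
      k = κ K
      w = v + κ (+ 4) * k
      v⁴ : (v * v) * (v * v) ≈ (v * v) * w + κ (+ 8) * k * (w * w)
      v⁴ = begin
        (v * v) * (v * v)                              ≈⟨ *-cong v² v² ⟩
        (e * w) * (e * w)                              ≈⟨ solve 2 (λ e w → (e :* w) :* (e :* w) := (e :* e) :* (w :* w)) refl e w ⟩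
        (e * e) * (w * w)                              ≈⟨ *-congʳ e² ⟩
        (e + κ (+ 8) * k) * (w * w)                    ≈⟨ solve 3 (λ e k w → (e :+ con (+ 8) :* k) :* (w :* w) := (e :* w) :* w :+ con (+ 8) :* k :* (w :* w)) refl e k w ⟩
        (e * w) * w + κ (+ 8) * k * (w * w)            ≈⟨ +-congʳ (*-congʳ v²) ⟨
        (v * v) * w + κ (+ 8) * k * (w * w)            ∎

-- Three residue maps to 𝔽₂

-- Pigeonhole in 𝔽₂: two of the three arguments coincide, but `f` separates the first from the other
-- two and `g` separates the second from the third.
two-residues : ∀ {f g : Parity → Parity} {t₁ t₂ t₃} →
  f t₁ ≡ 0ℙ → f t₂ ≡ 1ℙ → g t₂ ≡ 0ℙ → f t₃ ≡ 1ℙ → g t₃ ≡ 1ℙ → ⊥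
two-residues {t₁ = 0ℙ} {0ℙ}      f₁ f₂ g₂ f₃ g₃ with () ← ≡.trans (≡.sym f₁) f₂
two-residues {t₁ = 1ℙ} {1ℙ}      f₁ f₂ g₂ f₃ g₃ with () ← ≡.trans (≡.sym f₁) f₂
two-residues {t₁ = 0ℙ} {1ℙ} {0ℙ} f₁ f₂ g₂ f₃ g₃ with () ← ≡.trans (≡.sym f₁) f₃
two-residues {t₁ = 0ℙ} {1ℙ} {1ℙ} f₁ f₂ g₂ f₃ g₃ with () ← ≡.trans (≡.sym g₂) g₃
two-residues {t₁ = 1ℙ} {0ℙ} {0ℙ} f₁ f₂ g₂ f₃ g₃ with () ← ≡.trans (≡.sym g₂) g₃
two-residues {t₁ = 1ℙ} {0ℙ} {1ℙ} f₁ f₂ g₂ f₃ g₃ with () ← ≡.trans (≡.sym f₁) f₃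


module _ {c ℓ₁ ℓ₂} (L : FieldOverℚ c ℓ₁ ℓ₂) (b K : ℤ) (b≡ : b ≡ 1ℤ ℤ.+ + 32 ℤ.* K) (r₀ : ℕ)
  (irreducible : Irreducibleℚ (x^ (2 ℕ.^ (3 ℕ.+ r₀)) -const b))
  (α : FieldOverℚ.Carrier L) (root : IsRoot L (x^ (2 ℕ.^ (3 ℕ.+ r₀)) -const b) α)
  where
  open FieldExtension L
  open ℤAlgebra asℤAlgebra
  open IntegralElements L
  open Localization L b (3 ℕ.+ r₀) irreducible α root
  private
    module Ext = FieldExtension.SimpleExtension L b n 0<n irreducible α root

    y : Carrier
    y = α ^ (2 ℕ.^ (1 ℕ.+ r₀))

    y² : y * y ≈ α ^ (2 ℕ.^ (2 ℕ.+ r₀))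
    y² = trans (*-congˡ (sym (*-identityʳ y)))
      (trans (^-assocʳ α (2 ℕ.^ (1 ℕ.+ r₀)) 2) (^-congʳ α (ℕₚ.*-comm (2 ℕ.^ (1 ℕ.+ r₀)) 2)))

    y⁴ : (y * y) * (y * y) ≈ 1# + κ (+ 32) * κ K
    y⁴ = begin
      (y * y) * (y * y)                            ≈⟨ *-cong y² (trans y² (sym (*-identityʳ _))) ⟩
      (α ^ (2 ℕ.^ (2 ℕ.+ r₀))) ^ 2                 ≈⟨ ^-assocʳ α (2 ℕ.^ (2 ℕ.+ r₀)) 2 ⟩
      α ^ (2 ℕ.^ (2 ℕ.+ r₀) ℕ.* 2)                 ≈⟨ ^-congʳ α (ℕₚ.*-comm (2 ℕ.^ (2 ℕ.+ r₀)) 2) ⟩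
      α ^ n                                        ≈⟨ Ext.αⁿ≈b ⟩
      κ b                                          ≈⟨ reflexive (cong κ b≡) ⟩
      κ (1ℤ ℤ.+ + 32 ℤ.* K)                        ≈⟨ trans (κ-+ 1ℤ (+ 32 ℤ.* K)) (+-cong κ-1 (κ-* (+ 32) K)) ⟩
      1# + κ (+ 32) * κ K                          ∎
      where open ≈-Reasoning setoid

    e₀ v₀ : Carrier
    e₀ = e K y y⁴
    v₀ = v K y y⁴

    e∈ : ℚ⟨_⟩ L α e₀
    e∈ = mul (scalar ℚ.½) (add (mul (^∈ (2 ℕ.^ (1 ℕ.+ r₀))) (^∈ (2 ℕ.^ (1 ℕ.+ r₀)))) 1∈)

    v∈ : ℚ⟨_⟩ L α v₀
    v∈ = mul (scalar ℚ.½) (mul (add (^∈ (2 ℕ.^ (1 ℕ.+ r₀))) 1∈) e∈)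

    P₁ P₂ : Carrier
    P₁ = α ^ (2 ℕ.^ (1 ℕ.+ r₀)) + 1#
    P₂ = α ^ (2 ℕ.^ (2 ℕ.+ r₀)) + 1#

    2e : 2# ^ 1 * e₀ ≈ P₂
    2e = trans (*-congʳ (*-identityʳ 2#)) (trans (2*½* _) (+-congʳ y²))

    4v : 2# ^ 2 * v₀ ≈ P₁ * P₂
    4v = begin
      2# ^ 2 * v₀                   ≈⟨ solve 2 (λ t v → (t :* (t :* con 1ℤ)) :* v := t :* (t :* v)) refl 2# v₀ ⟩
      2# * (2# * v₀)                ≈⟨ *-congˡ (2*½* _) ⟩
      2# * (P₁ * e₀)                ≈⟨ solve 3 (λ t p e → t :* (p :* e) := p :* ((t :* con 1ℤ) :* e)) refl 2# P₁ e₀ ⟩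
      P₁ * (2# ^ 1 * e₀)            ≈⟨ *-congˡ 2e ⟩
      P₁ * P₂                       ∎
      where
      open ≈-Reasoning setoid
      open Solver

    valueℙ : List ℤ → Parity → Parity
    valueℙ = ℤAlgebra.value parityAlgebra

  -- The residue of `v` is read from `y`, which becomes a power of `γ` in ℤ only if `s ≤ 1 + r₀`.
  -- Quantifying over `i′` leaves the clause vacuous at the prime with `s = 2 + r₀`, where `y`
  -- becomes a square root of `γ`.
  Residues : List ℤ → List ℤ → ℕ → ℕ → Set
  Residues u w s i = ∃[ j ] ∃[ t ] parityℤ (half i j) ≡ valueℙ u t ×
    (∀ i′ → i′ ℕ.+ s ≡ 1 ℕ.+ r₀ → parityℤ (half i′ j ℤ.* half i j) ≡ valueℙ w t)

  -- At the prime obtained from the factor x^(2ˢ) - γ with γ ≡ 3 (mod 4), the residue of η is t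
  -- and the residues of e and v are read off from γ.
  residues : ∀ η k σ → parityℤ σ ≡ 1ℙ → ∀ q → κ ((+ 2) ℤ.^ k ℤ.* σ) * η ≈ value q α →
    ∀ D → (∀ i → ∃[ u ] List.length u ≡ D × η ^ i ≈ value u η) →
    ∀ u w → e₀ ≈ value u η → v₀ ≈ value w η →
    ∀ a s i → 3 ℕ.+ r₀ ≡ a ℕ.+ s → i ℕ.+ s ≡ 2 ℕ.+ r₀ → (∀ N → ApproximateRoot b a N) →
    Residues u w s i
  residues η k σ σ-odd q dη≈q D powers u w e≈u v≈w a s i r≡ i+s≡ approximate = j , E.ψ q′ ,
    At.residue η k σ σ-odd q dη≈q q′ q≈ u 1 (P i) (half i j) (k ℕ.* I ℕ.+ kw ℕ.+ 1) e≈u 2e (∼-P i i+s≡)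
      (E.trans (P≈ i) (E.*-congʳ (E.sym (E.*-identityʳ E.2#)))) N≡₁ ,
    λ i′ i′+s≡ → At.residue η k σ σ-odd q dη≈q q′ q≈ w 2 (P i′ E.* P i) (half i′ j ℤ.* half i j) (k ℕ.* I ℕ.+ ku) v≈w 4v
      (At.∼-* (∼-P i′ i′+s≡) (∼-P i i+s≡)) (product i′) N≡₂
    where
    I ku kw N : ℕ
    I  = 2 ℕ.^ s ℕ.* suc (k ℕ.* D)
    ku = k ℕ.* List.length u
    kw = k ℕ.* List.length w
    -- The summand `k I` pays for dividing `q(ρ)` by `2ᵏ`. The residue of `e` costs `ku + 1 + 1` and
    -- that of `v` costs `kw + 2 + 1`: the denominators of `η`, the factor 2 or 4, and one more 2
    -- for an even error. The sum covers each of these demands.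
    N  = k ℕ.* I ℕ.+ (ku ℕ.+ (kw ℕ.+ 3))
    root-mod : ApproximateRoot b a N
    root-mod = approximate N
    j γ : ℤ
    j = proj₁ root-mod
    γ = + 4 ℤ.* j ℤ.+ + 3
    Eᵣ : EisensteinRing γ s
    Eᵣ = eisensteinRing j s
    module E = EisensteinRing Eᵣ
    module At = AtPrime Eᵣ a N r≡ (proj₁ (proj₂ root-mod)) (proj₂ (proj₂ root-mod))
    divisible : ∃[ q′ ] E.value q E.ρ E.≈ E.2# E.^ k E.* q′
    divisible = At.integral⇒divisible η k σ σ-odd q dη≈q D powers (ku ℕ.+ (kw ℕ.+ 3)) ≡.refl
    q′ : E.Carrier
    q′ = proj₁ divisible
    q≈ : E.value q E.ρ E.≈ E.2# E.^ k E.* q′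
    q≈ = proj₂ divisible
    P : ℕ → E.Carrier
    P i = E.ρ E.^ (2 ℕ.^ (i ℕ.+ s)) E.+ E.1#
    ∼-P : ∀ i {m} → i ℕ.+ s ≡ m → (α ^ (2 ℕ.^ m) + 1#) At.∼ P i
    ∼-P i ≡.refl = At.∼-+ (At.∼-^ (2 ℕ.^ (i ℕ.+ s)) At.∼-generator) At.∼-1
    P≈ : ∀ i → P i E.≈ E.2# E.* E.κ (half i j)
    P≈ i = begin
      P i                                      ≈⟨ E.+-cong (At.ρ-power i) (E.sym E.κ-1) ⟩
      E.κ (γ ℤ.^ (2 ℕ.^ i)) E.+ E.κ 1ℤ         ≈⟨ E.κ-+ (γ ℤ.^ (2 ℕ.^ i)) 1ℤ ⟨
      E.κ (γ ℤ.^ (2 ℕ.^ i) ℤ.+ 1ℤ)             ≈⟨ E.reflexive (cong E.κ (half-spec i j)) ⟩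
      E.κ (+ 2 ℤ.* half i j)                   ≈⟨ E.κ-* (+ 2) (half i j) ⟩
      E.2# E.* E.κ (half i j)                  ∎
      where open ≈-Reasoning E.setoid
    product : ∀ i′ → P i′ E.* P i E.≈ E.2# E.^ 2 E.* E.κ (half i′ j ℤ.* half i j)
    product i′ = begin
      P i′ E.* P i                                                           ≈⟨ E.*-cong (P≈ i′) (P≈ i) ⟩
      (E.2# E.* E.κ (half i′ j)) E.* (E.2# E.* E.κ (half i j))
        ≈⟨ solve 3 (λ t m n → (t :* m) :* (t :* n) := (t :* (t :* con 1ℤ)) :* (m :* n)) E.refl E.2# (E.κ (half i′ j)) (E.κ (half i j)) ⟩
      E.2# E.^ 2 E.* (E.κ (half i′ j) E.* E.κ (half i j))                    ≈⟨ E.*-congˡ (E.κ-* (half i′ j) (half i j)) ⟨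
      E.2# E.^ 2 E.* E.κ (half i′ j ℤ.* half i j)                            ∎
      where
      open ≈-Reasoning E.setoid
      open E.Solver
    N≡₁ : N ≡ ku ℕ.+ (1 ℕ.+ suc (k ℕ.* I ℕ.+ kw ℕ.+ 1))
    N≡₁ = solve 3 (λ i u w → i :+ (u :+ (w :+ con 3)) := u :+ (con 1 :+ (con 1 :+ (i :+ w :+ con 1)))) ≡.refl (k ℕ.* I) ku kw
      where open ℕSolver
    N≡₂ : N ≡ kw ℕ.+ (2 ℕ.+ suc (k ℕ.* I ℕ.+ ku))
    N≡₂ = solve 3 (λ i u w → i :+ (u :+ (w :+ con 3)) := w :+ (con 2 :+ (con 1 :+ (i :+ u)))) ≡.refl (k ℕ.* I) ku kw
      where open ℕSolver

  -- At the first prime `y²` is `γ`, so `e` has residue 0. At the second `y` is `γ`, so `e` has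
  -- residue 1, and the even `half 0` gives `v` residue 0. At the third `y` is `γ²`, and both
  -- factors of `v` are odd.
  three-primes : ∀ u w → Residues u w (2 ℕ.+ r₀) 0 → Residues u w (1 ℕ.+ r₀) 1 → Residues u w r₀ 2 → ⊥
  three-primes u w (j₁ , t₁ , u₁ , _) (j₂ , t₂ , u₂ , w₂) (j₃ , t₃ , u₃ , w₃) =
    two-residues {valueℙ u} {valueℙ w} {t₁} {t₂} {t₃}
      (≡.trans (≡.sym u₁) (half-zero-even j₁))
      (≡.trans (≡.sym u₂) (half-suc-odd 0 j₂))
      (≡.trans (≡.sym (w₂ 0 ≡.refl)) (≡.trans (parityℤ-homo-* (half 0 j₂) (half 1 j₂)) (cong (ℙ._* parityℤ (half 1 j₂)) (half-zero-even j₂))))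
      (≡.trans (≡.sym u₃) (half-suc-odd 1 j₃))
      (≡.trans (≡.sym (w₃ 1 ≡.refl)) (odd-* (half 1 j₃) (half 2 j₃) (half-suc-odd 0 j₃) (half-suc-odd 1 j₃)))

  no-generator : ∀ η p → η ≈ eval L p α → IsIntegral L η → ∀ u w → e₀ ≈ value u η → v₀ ≈ value w η → ⊥
  no-generator η p η≈p η-integral u w e≈u v≈w = three-primes u w
    -- In the three lines `γ` is `-c⁴`, `-c²` and `-c`. The precision depends on `s`, so each prime
    -- takes its own `c`; only the class of `γ` modulo 4 is compared in the end.
    (residues-at 1 (2 ℕ.+ r₀) 0 ≡.refl ≡.refl (λ N → negative-root b N 0 (sq-root b N 1 (sq-root b N 2 (8th-root N)))))
    (residues-at 2 (1 ℕ.+ r₀) 1 ≡.refl ≡.refl (λ N → negative-root b N 1 (sq-root b N 2 (8th-root N))))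
    (residues-at 3 r₀ 2 ≡.refl ≡.refl (λ N → negative-root b N 2 (8th-root N)))
    where
    8th-root : ∀ N → PositiveRoot b 3 N
    8th-root = positive-8th-root b K b≡
    d : ℤ
    d = proj₁ (clear-denominators L p)
    q : List ℤ
    q = proj₁ (proj₂ (clear-denominators L p))
    open OddPart (proj₁ (proj₂ (proj₂ (clear-denominators L p))))
    dη≈q : κ ((+ 2) ℤ.^ k ℤ.* s) * η ≈ value q α
    dη≈q = trans (*-cong (reflexive (cong κ (≡.sym d≡))) η≈p) (proj₂ (proj₂ (proj₂ (clear-denominators L p))) α)
    residues-at : ∀ a s i → 3 ℕ.+ r₀ ≡ a ℕ.+ s → i ℕ.+ s ≡ 2 ℕ.+ r₀ → (∀ N → ApproximateRoot b a N) → Residues u w s i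
    residues-at = residues η k s odd q dη≈q (proj₁ (integral-powers η-integral)) (proj₂ (integral-powers η-integral)) u w e≈u v≈w

  not-monogenic : ¬ Monogenic L (ℚ⟨_⟩ L α)
  not-monogenic (η , (η∈ , η-integral) , 𝓞⇔ℤ[η]) = no-generator η (proj₁ polynomial) (proj₂ polynomial) η-integral
    (proj₁ e-value) (proj₁ v-value)
    (trans (proj₂ e-value) (evalℤ≈ (proj₁ e-value) η)) (trans (proj₂ v-value) (evalℤ≈ (proj₁ v-value) η))
    where
    polynomial : ∃[ p ] η ≈ eval L p α
    polynomial = Ext.∈ℚ⟨α⟩⇒polynomial η∈
    e-value : ∃[ u ] e₀ ≈ evalℤ L u η
    e-value = Equivalence.to (𝓞⇔ℤ[η] e₀) (e∈ , e-integral K y y⁴)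
    v-value : ∃[ w ] v₀ ≈ evalℤ L w η
    v-value = Equivalence.to (𝓞⇔ℤ[η] v₀) (v∈ , v-integral K y y⁴)

∣-1⇒≡1+ : ∀ {m b} → m ∣ b ℤ.- 1ℤ → ∃[ K ] b ≡ 1ℤ ℤ.+ m ℤ.* K
∣-1⇒≡1+ {m} {b} m∣b-1 = quotient , (begin
  b                         ≡⟨ shift b ⟩
  1ℤ ℤ.+ (b ℤ.- 1ℤ)         ≡⟨ cong (λ x → 1ℤ ℤ.+ x) (≡.trans equality (ℤₚ.*-comm quotient m)) ⟩
  1ℤ ℤ.+ m ℤ.* quotient     ∎)
  where
  open Signed._∣_ (Signed.∣ᵤ⇒∣ {m} {b ℤ.- 1ℤ} m∣b-1)
  open ≡-Reasoning
  shift : ∀ b → b ≡ 1ℤ ℤ.+ (b ℤ.- 1ℤ)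
  shift = solve 1 (λ b → b := con 1ℤ :+ (b :- con 1ℤ)) ≡.refl
    where open ℤSolver

not-monogenic-from-3 : ∀ b K → b ≡ 1ℤ ℤ.+ + 32 ℤ.* K → ∀ r r₀ → 3 ℕ.+ r₀ ≡ r →
  Irreducibleℚ (x^ (2 ℕ.^ r) -const b) →
  ∀ {c ℓ₁ ℓ₂} (L : FieldOverℚ c ℓ₁ ℓ₂) (α : FieldOverℚ.Carrier L) →
  IsRoot L (x^ (2 ℕ.^ r) -const b) α → ¬ Monogenic L (ℚ⟨_⟩ L α)
not-monogenic-from-3 b K b≡ _ r₀ ≡.refl irreducible L α root = not-monogenic L b K b≡ r₀ irreducible α root

open import Data.Integer.Base using (_-_)
open import Data.Nat.Base using (_^_)

corollary1p8 : ∀ (b : ℤ) → + 32 ∣ b - + 1 →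
    ∀ (r : ℕ) → 3 ≤ r → Irreducibleℚ (x^ (2 ^ r) -const b) →
    ∀ {c ℓ₁ ℓ₂} (L : FieldOverℚ c ℓ₁ ℓ₂) (α : FieldOverℚ.Carrier L) →
    IsRoot L (x^ (2 ^ r) -const b) α →
    ¬ Monogenic L (ℚ⟨_⟩ L α)
corollary1p8 b 32∣b-1 r 3≤r = not-monogenic-from-3 b (proj₁ (∣-1⇒≡1+ {+ 32} {b} 32∣b-1)) (proj₂ (∣-1⇒≡1+ {+ 32} {b} 32∣b-1))
  r (proj₁ (ℕₚ.m≤n⇒∃[o]m+o≡n 3≤r)) (proj₂ (ℕₚ.m≤n⇒∃[o]m+o≡n 3≤r))
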